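{- For all integers $r\ge 3$ and $t$ with $1\le t\le r-2$, there exists an integer $n(r,t)$ such that for every $n\ge n(r,t)$, $$\iota_0(t,n;r) = \max\left\{n^{r-t}-(n-1)^{r-t}+t(n-1),\ (t+2)n^{r-t-1}-(t+1)n^{r-t-2}\right\}.$$
   Context: For $1\le \ell\le r$ let $X_\ell=\{1,\dots,n_\ell\}$. For $A=(a_1,\dots,a_r),B=(b_1,\dots,b_r)\in X_1\times\dots\times X_r$, let $A\cap B=\{\ell\in[r]: a_\ell=b_\ell\}$. A family $\mathcal{F}\subseteq X_1\times\dots\times X_r$ is $t$-intersecting if $|A\cap B|\ge t$ for all $A,B\in\mathcal{F}$. Let $\bigcap\mathcal{F}$ be the set of indices $\ell\in[r]$ such that all members of $\mathcal{F}$ have the same $\ell$-th coordinate. For integers $r>t\ge1$ and $n_1\ge\dots\ge n_r\ge 2$, $\iota_0(t,n_1,\dots,n_r)$ is the maximum size of a $t$-intersecting family $\mathcal{F}\subseteq X_1\times\dots\times X_r$ with $|\bigcap\mathcal{F}|<t$; $\iota_0(t,n;r)$ denotes $\iota_0(t,n,\dots,n)$ with $r$ arguments equal to $n$. -}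

module Defs where

open import Data.Nat using (ℕ; _≤_; _<_)
open import Data.Fin using (Fin)
open import Data.Fin.Properties using (_≟_)
open import Data.Fin.Subset using (Subset; ∣_∣)
open import Data.Vec using (Vec; lookup; tabulate)
open import Data.List using (List; length)
open import Data.List.Relation.Unary.All using (All; all?)
open import Data.List.Relation.Unary.Unique.Propositional using (Unique)
open import Data.Product using (Σ; _×_)
open import Relation.Nullary using (does)
open import Relation.Binary.PropositionalEquality using (_≡_)

-- An element of X_1 × ... × X_r with all X_ℓ = {1..n}, modelled as Fin n (0-based).
Tuple : ℕ → ℕ → Set
Tuple n r = Vec (Fin n) r

agree : ∀ {n r} → Tuple n r → Tuple n r → Subset r
agree A B = tabulate (λ ℓ → does (lookup A ℓ ≟ lookup B ℓ))

record Family (n r : ℕ) : Set where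
  constructor family
  field
    members : List (Tuple n r)
    distinct : Unique members
open Family public

TIntersecting : ∀ {n r} → ℕ → List (Tuple n r) → Set
TIntersecting t F = All (λ A → All (λ B → t ≤ ∣ agree A B ∣) F) F

common : ∀ {n r} → List (Tuple n r) → Subset r
common F = tabulate (λ ℓ → does (all? (λ A → all? (λ B → lookup A ℓ ≟ lookup B ℓ) F) F))

Admissible : ∀ {n r} → ℕ → Family n r → Set
Admissible t F = TIntersecting t (members F) × ∣ common (members F) ∣ < t

Iota0Is : ℕ → ℕ → ℕ → ℕ → Set
Iota0Is t n r m =
  Σ (Family n r) (λ F → Admissible t F × length (members F) ≡ m)
  × (∀ (F : Family n r) → Admissible t F → length (members F) ≤ m)

{-# OPTIONS --safe #-}
module Submission where

-- Work with partial tuples.  Put k = r - t, and call a partial tuple S of size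
-- t + 1 heavy if more than r n^(k-2) members of F extend it.
--
-- No partial tuple of size at most t is met t times by all of F, so branching t + 1
-- times on members of F that meet the current one too rarely yields at most
-- r^(t+1) partial tuples of size t + 1, one of which every member extends.
-- If fewer than k of them are heavy, then |F| ≤ (k-1) n^(k-1) + O(n^(k-2)), which is
-- below n^k - (n-1)^k for large n.
--
-- Heavy tuples are met at least t times by every member of F and by each other.
-- If three of them have fewer than t common entries, then all members of F agree
-- with their majority, of size t + 2, up to one entry.  Otherwise all of them extend
-- the t common entries T of two of them, and a member B that does not extend T
-- forces them to be T plus one entry of B; k of them exhaust the k entries available.
-- Then the members extending T meet B outside T, and the others differ from T in one
-- entry and coincide with B outside T.
--
-- Both extremal families contain a Hamming ball of radius 1, so their members
-- have no coordinate in common.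

open import Defs
open import Data.Nat using (ℕ; zero; suc; _≤_; _<_; _+_; _*_; _∸_; _^_; _⊔_; z≤n; s≤s; s≤s⁻¹; _≤?_; _<?_)
open import Data.Nat.Properties hiding (_≟_)
open import Data.Nat.Tactic.RingSolver using (solve-∀)
open import Data.Bool using (Bool; true; false; if_then_else_)
open import Data.Maybe using (Maybe; just; nothing)
open import Data.Maybe.Properties using (≡-dec)
open import Data.Fin using (Fin; zero; suc; punchIn)
open import Data.Fin.Properties using (_≟_; punchIn-injective; punchInᵢ≢i; punchIn-punchOut)
open import Data.Fin.Subset using (∣_∣)
open import Data.Vec using (Vec; []; _∷_; lookup; tabulate)
import Data.Vec as Vec
open import Data.Vec.Properties as Vec using (∷-injective; ∷-injectiveˡ; ∷-injectiveʳ)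
open import Data.Vec.Relation.Binary.Pointwise.Inductive as Pointwise using (Pointwise; []; _∷_)
open import Data.List using (List; []; _∷_; [_]; length; map; _++_; concatMap; filter; allFin; cartesianProductWith; deduplicate)
open import Data.List.Properties using (length-map; length-++; length-tabulate; length-deduplicate)
open import Data.List.Membership.Propositional using (_∈_; find; lose)
open import Data.List.Membership.Propositional.Properties
open import Data.List.Relation.Unary.Any as Any using (here; there)
open import Data.List.Relation.Unary.All as All using ([]; _∷_; all?)
open import Data.List.Relation.Unary.AllPairs using ([]; _∷_)
open import Data.List.Relation.Unary.Unique.Propositional using (Unique)
import Data.List.Relation.Unary.Unique.Propositional.Properties as Unique
open import Data.List.Relation.Unary.Unique.DecPropositional.Properties using (deduplicate-!)
open import Data.List.Relation.Binary.Subset.Propositional using (_⊆_)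
open import Data.Product using (Σ; ∃-syntax; _×_; _,_; proj₁; proj₂; map₁; map₂)
open import Data.Sum using (_⊎_; inj₁; inj₂; [_,_]′)
open import Data.Empty using (⊥-elim)
open import Function using (_∘_; id; _⇔_; mk⇔; Equivalence)
open import Relation.Nullary using (¬_; Dec; does; yes; no; contradiction)
open import Relation.Nullary.Decidable using (dec-true; dec-false)
open import Relation.Binary.Definitions using (DecidableEquality)
open import Relation.Binary.PropositionalEquality using (_≡_; _≢_; refl; sym; trans; cong; cong₂; subst; subst₂; module ≡-Reasoning)

private
  variable
    n p r : ℕ

-- Pigeonhole for lists without repetition.

module _ {X : Set} where

  remove : {x : X} {ys : List X} → x ∈ ys → List X
  remove {ys = _ ∷ ys} (here _)      = ys
  remove {ys = y ∷ _}  (there x∈ys) = y ∷ remove x∈ys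

  length-remove : {x : X} {ys : List X} (x∈ys : x ∈ ys) → suc (length (remove x∈ys)) ≡ length ys
  length-remove (here _)     = refl
  length-remove (there x∈ys) = cong suc (length-remove x∈ys)

  ∈-remove : {x z : X} {ys : List X} (x∈ys : x ∈ ys) → z ≢ x → z ∈ ys → z ∈ remove x∈ys
  ∈-remove (here refl)  z≢x (here z≡x)   = contradiction z≡x z≢x
  ∈-remove (here _)     z≢x (there z∈ys) = z∈ys
  ∈-remove (there x∈ys) z≢x (here z≡y)   = here z≡y
  ∈-remove (there x∈ys) z≢x (there z∈ys) = there (∈-remove x∈ys z≢x z∈ys)

  unique-⊆⇒length≤ : {xs ys : List X} → Unique xs → xs ⊆ ys → length xs ≤ length ys
  unique-⊆⇒length≤ []           _     = z≤n
  unique-⊆⇒length≤ (x∉xs ∷ xs!) xs⊆ys =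
    ≤-trans
      (s≤s (unique-⊆⇒length≤ xs! λ z∈xs →
        ∈-remove x∈ys (All.lookup x∉xs z∈xs ∘ sym) (xs⊆ys (there z∈xs))))
      (≤-reflexive (length-remove x∈ys))
    where x∈ys = xs⊆ys (here refl)

  unique-⊆-length≥⇒⊇ : DecidableEquality X → {xs ys : List X} →
    Unique xs → xs ⊆ ys → length ys ≤ length xs → ys ⊆ xs
  unique-⊆-length≥⇒⊇ _≟ˣ_ {xs} {ys} xs! xs⊆ys ge {y} y∈ys with Any.any? (y ≟ˣ_) xs
  ... | yes y∈xs = y∈xs
  ... | no  y∉xs = contradiction (≤-trans (unique-⊆⇒length≤ y∷xs! y∷xs⊆ys) ge) (<-irrefl refl)
    where
    y∷xs! : Unique (y ∷ xs)
    y∷xs! = All.tabulate (λ z∈xs y≡z → y∉xs (subst (_∈ xs) (sym y≡z) z∈xs)) ∷ xs!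
    y∷xs⊆ys : y ∷ xs ⊆ ys
    y∷xs⊆ys (here refl)  = y∈ys
    y∷xs⊆ys (there z∈xs) = xs⊆ys z∈xs

length-cartesianProductWith : {X Y Z : Set} (f : X → Y → Z) (xs : List X) (ys : List Y) →
  length (cartesianProductWith f xs ys) ≡ length xs * length ys
length-cartesianProductWith f []       ys = refl
length-cartesianProductWith f (x ∷ xs) ys =
  trans (length-++ (map (f x) ys))
    (cong₂ _+_ (length-map (f x) ys) (length-cartesianProductWith f xs ys))

-- Enumerations of sets of tuples

-- An exact enumeration serves both halves of the theorem: completeness bounds any family inside `P`
-- by `c`, and soundness turns the list itself into a family of size `c`.
record Enum (P : Tuple n r → Set) (c : ℕ) : Set where
  field
    list     : List (Tuple n r)
    unique   : Unique list
    sound    : ∀ {A} → A ∈ list → P A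
    complete : ∀ {A} → P A → A ∈ list
    count    : length list ≡ c
open Enum

bounded : {P : Tuple n r → Set} {c : ℕ} → Enum P c →
  {F : List (Tuple n r)} → Unique F → (∀ {A} → A ∈ F → P A) → length F ≤ c
bounded E F! F⊆P = subst (_ ≤_) (count E) (unique-⊆⇒length≤ F! (complete E ∘ F⊆P))

recount : {P : Tuple n r → Set} {c d : ℕ} → c ≡ d → Enum P c → Enum P d
recount refl E = E

none : {P : Tuple n r → Set} → (∀ A → ¬ P A) → Enum P 0
none ¬P = record
  { list = [] ; unique = [] ; sound = λ () ; complete = λ {A} PA → ⊥-elim (¬P A PA) ; count = refl }

single : {P : Tuple n 0 → Set} → P [] → Enum P 1
single P[] = record
  { list = [ [] ] ; unique = [] ∷ [] ; sound = λ { (here refl) → P[] }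
  ; complete = λ { {[]} _ → here refl } ; count = refl }

union : {P Q : Tuple n r → Set} {c d : ℕ} → Enum P c → Enum Q d → (∀ {A} → P A → ¬ Q A) →
  Enum (λ A → P A ⊎ Q A) (c + d)
union E D disjoint = record
  { list     = list E ++ list D
  ; unique   = Unique.++⁺ (unique E) (unique D) λ (∈E , ∈D) → disjoint (sound E ∈E) (sound D ∈D)
  ; sound    = λ A∈ → [ inj₁ ∘ sound E , inj₂ ∘ sound D ]′ (∈-++⁻ (list E) A∈)
  ; complete = [ ∈-++⁺ˡ ∘ complete E , ∈-++⁺ʳ (list E) ∘ complete D ]′
  ; count    = trans (length-++ (list E)) (cong₂ _+_ (count E) (count D))
  }

others : Fin (suc p) → List (Fin (suc p))
others w = map (punchIn w) (allFin _)

others-unique : (w : Fin (suc p)) → Unique (others w)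
others-unique w = Unique.map⁺ (punchIn-injective w _ _) (Unique.allFin⁺ _)

∈-others⁺ : {w v : Fin (suc p)} → v ≢ w → v ∈ others w
∈-others⁺ {w = w} v≢w = subst (_∈ others w) (punchIn-punchOut (v≢w ∘ sym)) (∈-map⁺ (punchIn w) (∈-allFin _))

∈-others⁻ : {w v : Fin (suc p)} → v ∈ others w → v ≢ w
∈-others⁻ {w = w} v∈ v≡w with i , _ , v≡ ← ∈-map⁻ (punchIn w) v∈ = punchInᵢ≢i w i (trans (sym v≡) v≡w)

length-others : (w : Fin (suc p)) → length (others w) ≡ p
length-others w = trans (length-map (punchIn w) (allFin _)) (length-tabulate id)

module _ {R : Tuple (suc p) (suc r) → Set} {P Q : Tuple (suc p) r → Set} {c d : ℕ} where

  open Equivalence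

  -- Conditioning on the first coordinate: one distinguished value leaves `P` for the tail and each
  -- of the `p` others leaves `Q`. Every recursive enumeration below has this form.
  split : (w : Fin (suc p)) → Enum P c → Enum Q d →
    (∀ {A} → R (w ∷ A) ⇔ P A) → (∀ {v A} → v ≢ w → R (v ∷ A) ⇔ Q A) → Enum R (c + p * d)
  split w E D same other = record
    { list     = head ++ tail
    ; unique   = Unique.++⁺ (Unique.map⁺ ∷-injectiveʳ (unique E))
                   (Unique.cartesianProductWith⁺ _∷_ ∷-injective (others-unique w) (unique D))
                   disjoint
    ; sound    = λ A∈ → [ head-sound , tail-sound ]′ (∈-++⁻ head A∈)
    ; complete = λ { {v ∷ A} → split-complete v A }
    ; count    = trans (length-++ head) (cong₂ _+_ (trans (length-map (w ∷_) (list E)) (count E))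
                   (trans (length-cartesianProductWith _∷_ (others w) (list D))
                     (cong₂ _*_ (length-others w) (count D))))
    }
    where
    head = map (w ∷_) (list E)
    tail = cartesianProductWith _∷_ (others w) (list D)
    head-sound : ∀ {A} → A ∈ head → R A
    head-sound A∈ with _ , A′∈ , refl ← ∈-map⁻ (w ∷_) A∈ = from same (sound E A′∈)
    tail-sound : ∀ {A} → A ∈ tail → R A
    tail-sound A∈ with _ , _ , v∈ , A′∈ , refl ← ∈-cartesianProductWith⁻ _∷_ (others w) (list D) A∈ =
      from (other (∈-others⁻ v∈)) (sound D A′∈)
    disjoint : ∀ {A} → ¬ (A ∈ head × A ∈ tail)
    disjoint (A∈h , A∈t)
      with _ , _ , refl ← ∈-map⁻ (w ∷_) A∈h
      with _ , _ , v∈ , _ , eq ← ∈-cartesianProductWith⁻ _∷_ (others w) (list D) A∈t =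
      ∈-others⁻ v∈ (sym (∷-injectiveˡ eq))
    split-complete : ∀ v A → R (v ∷ A) → v ∷ A ∈ head ++ tail
    split-complete v A Rv∷A with v ≟ w
    ... | yes refl = ∈-++⁺ˡ (∈-map⁺ (w ∷_) (complete E (to same Rv∷A)))
    ... | no  v≢w  = ∈-++⁺ʳ head (∈-cartesianProductWith⁺ _∷_ (∈-others⁺ v≢w) (complete D (to (other v≢w) Rv∷A)))

-- Partial tuples

-- `nothing` marks a free coordinate. Full tuples embed through `⌜_⌝`, so agreement, inclusion and
-- overlap can all be measured by `hits`, in which a free coordinate never counts.
Partial : ℕ → ℕ → Set
Partial n r = Vec (Maybe (Fin n)) r

⌜_⌝ : Tuple n r → Partial n r
⌜_⌝ = Vec.map just

weight : Maybe (Fin n) → ℕ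
weight nothing  = 0
weight (just _) = 1

size : Partial n r → ℕ
size []      = 0
size (x ∷ S) = weight x + size S

gaps : Partial n r → ℕ
gaps []            = 0
gaps (nothing ∷ S) = suc (gaps S)
gaps (just _ ∷ S)  = gaps S

hit : Maybe (Fin n) → Maybe (Fin n) → ℕ
hit (just a) (just b) = if does (a ≟ b) then 1 else 0
hit (just _) nothing  = 0
hit nothing  _        = 0

hits : Partial n r → Partial n r → ℕ
hits []      []      = 0
hits (x ∷ S) (y ∷ Q) = hit x y + hits S Q

data _≼_ {n : ℕ} : Maybe (Fin n) → Maybe (Fin n) → Set where
  free : ∀ {y} → nothing ≼ y
  same : ∀ {a} → just a ≼ just a

infix 4 _⊑_ _≼_

_⊑_ : Partial n r → Partial n r → Set
_⊑_ = Pointwise _≼_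

_≼?_ : (x y : Maybe (Fin n)) → Dec (x ≼ y)
nothing ≼? _ = yes free
just a ≼? nothing = no λ ()
just a ≼? just b with a ≟ b
... | yes refl = yes same
... | no  a≢b  = no λ { same → a≢b refl }

_⊑?_ : (S Q : Partial n r) → Dec (S ⊑ Q)
_⊑?_ = Pointwise.decidable _≼?_

hit-same : (a : Fin n) → hit (just a) (just a) ≡ 1
hit-same a with a ≟ a
... | yes _   = refl
... | no  a≢a = contradiction refl a≢a

hit-diff : {a b : Fin n} → a ≢ b → hit (just a) (just b) ≡ 0
hit-diff {a = a} {b} a≢b with a ≟ b
... | yes a≡b = contradiction a≡b a≢b
... | no  _   = refl

hit-comm : (x y : Maybe (Fin n)) → hit x y ≡ hit y x
hit-comm nothing  nothing  = refl
hit-comm nothing  (just _) = refl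
hit-comm (just _) nothing  = refl
hit-comm (just a) (just b) with a ≟ b
... | yes refl = sym (hit-same a)
... | no  a≢b  = sym (hit-diff (a≢b ∘ sym))

hits-comm : (S Q : Partial n r) → hits S Q ≡ hits Q S
hits-comm []      []      = refl
hits-comm (x ∷ S) (y ∷ Q) = cong₂ _+_ (hit-comm x y) (hits-comm S Q)

hit≤weight : (x y : Maybe (Fin n)) → hit x y ≤ weight x
hit≤weight nothing  _        = z≤n
hit≤weight (just _) nothing  = z≤n
hit≤weight (just a) (just b) with does (a ≟ b)
... | true  = ≤-refl
... | false = z≤n

hits≤size : (S Q : Partial n r) → hits S Q ≤ size S
hits≤size []      []      = z≤n
hits≤size (x ∷ S) (y ∷ Q) = +-mono-≤ (hit≤weight x y) (hits≤size S Q)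

⊑⇒hits≡size : {S Q : Partial n r} → S ⊑ Q → hits S Q ≡ size S
⊑⇒hits≡size []                   = refl
⊑⇒hits≡size (free ∷ S⊑Q)         = ⊑⇒hits≡size S⊑Q
⊑⇒hits≡size (same {a = a} ∷ S⊑Q) = cong₂ _+_ (hit-same a) (⊑⇒hits≡size S⊑Q)

size≤hits⇒⊑ : (S Q : Partial n r) → size S ≤ hits S Q → S ⊑ Q
size≤hits⇒⊑ []            []            _ = []
size≤hits⇒⊑ (nothing ∷ S) (_ ∷ Q)       le = free ∷ size≤hits⇒⊑ S Q le
size≤hits⇒⊑ (just a ∷ S)  (nothing ∷ Q) le = contradiction (≤-trans le (hits≤size S Q)) (<-irrefl refl)
size≤hits⇒⊑ (just a ∷ S)  (just b ∷ Q) le with a ≟ b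
... | yes refl = same ∷ size≤hits⇒⊑ S Q (s≤s⁻¹ le)
... | no  _    = contradiction (≤-trans le (hits≤size S Q)) (<-irrefl refl)

⊑⇒size≤ : {S Q : Partial n r} → S ⊑ Q → size S ≤ size Q
⊑⇒size≤ {S = S} {Q} S⊑Q = begin
  size S   ≡⟨ ⊑⇒hits≡size S⊑Q ⟨
  hits S Q ≡⟨ hits-comm S Q ⟩
  hits Q S ≤⟨ hits≤size Q S ⟩
  size Q   ∎
  where open ≤-Reasoning

⊑-size≥⇒≡ : {S Q : Partial n r} → S ⊑ Q → size Q ≤ size S → S ≡ Q
⊑-size≥⇒≡ []                         _ = refl
⊑-size≥⇒≡ (free {nothing} ∷ S⊑Q)     ge = cong (nothing ∷_) (⊑-size≥⇒≡ S⊑Q ge)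
⊑-size≥⇒≡ (free {just _} ∷ S⊑Q)      ge = contradiction (≤-trans ge (⊑⇒size≤ S⊑Q)) (<-irrefl refl)
⊑-size≥⇒≡ (same {a = a} ∷ S⊑Q)       ge = cong (just a ∷_) (⊑-size≥⇒≡ S⊑Q (s≤s⁻¹ ge))

hits-monoˡ : {S Q : Partial n r} → S ⊑ Q → (P : Partial n r) → hits S P ≤ hits Q P
hits-monoˡ []           []      = z≤n
hits-monoˡ (free ∷ S⊑Q) (x ∷ P) = m≤n⇒m≤o+n _ (hits-monoˡ S⊑Q P)
hits-monoˡ (same {a = a} ∷ S⊑Q) (x ∷ P) = +-monoʳ-≤ (hit (just a) x) (hits-monoˡ S⊑Q P)

gaps+size : (S : Partial n r) → gaps S + size S ≡ r
gaps+size []            = refl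
gaps+size (nothing ∷ S) = cong suc (gaps+size S)
gaps+size (just _ ∷ S)  = trans (+-suc (gaps S) (size S)) (cong suc (gaps+size S))

-- Two agreements with z force an agreement with each other.
hit-triangle : (z x y : Maybe (Fin n)) → hit z x + hit z y ≤ hit x y + weight z
hit-triangle nothing  x        y        = z≤n
hit-triangle (just c) nothing  nothing  = z≤n
hit-triangle (just c) nothing  (just b) = hit≤weight (just c) (just b)
hit-triangle (just c) (just a) nothing  = ≤-trans (≤-reflexive (+-identityʳ _)) (hit≤weight (just c) (just a))
hit-triangle (just c) (just a) (just b) with c ≟ a | c ≟ b
... | no  _    | no  _    = z≤n
... | no  _    | yes _    = m≤n+m 1 _
... | yes _    | no  _    = m≤n+m 1 _
... | yes refl | yes refl = +-monoˡ-≤ 1 (≤-reflexive (sym (hit-same c)))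

interchange : ∀ a b c d → (a + b) + (c + d) ≡ (a + c) + (b + d)
interchange = solve-∀

-- Pigeonhole inside `Z`: the entries shared with `S` and those shared with `Q` overlap in at least
-- `hits Z S + hits Z Q - size Z` places, where `S` and `Q` agree. Most intersection bounds below
-- come from this.
hits-triangle : (Z S Q : Partial n r) → hits Z S + hits Z Q ≤ hits S Q + size Z
hits-triangle []      []      []      = z≤n
hits-triangle (z ∷ Z) (x ∷ S) (y ∷ Q) =
  subst₂ _≤_ (interchange (hit z x) _ _ _) (interchange (hit x y) _ _ _)
    (+-mono-≤ (hit-triangle z x y) (hits-triangle Z S Q))

size-⌜⌝ : (A : Tuple n r) → size ⌜ A ⌝ ≡ r
size-⌜⌝ []      = refl
size-⌜⌝ (_ ∷ A) = cong suc (size-⌜⌝ A)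

∣agree∣ : (A B : Tuple n r) → ∣ agree A B ∣ ≡ hits ⌜ A ⌝ ⌜ B ⌝
∣agree∣ []      []      = refl
∣agree∣ (a ∷ A) (b ∷ B) with does (a ≟ b)
... | true  = cong suc (∣agree∣ A B)
... | false = ∣agree∣ A B

-- One-entry extensions of a partial tuple along another one.

kids : Partial n r → Partial n r → List (Partial n r)
kids []            []            = []
kids (nothing ∷ S) (just b ∷ P)  = (just b ∷ S) ∷ map (nothing ∷_) (kids S P)
kids (nothing ∷ S) (nothing ∷ P) = map (nothing ∷_) (kids S P)
kids (just a ∷ S)  (_ ∷ P)       = map (just a ∷_) (kids S P)

length-kids : (S P : Partial n r) → length (kids S P) ≤ gaps S
length-kids []            []            = z≤n
length-kids (nothing ∷ S) (just b ∷ P)  = s≤s (≤-trans (≤-reflexive (length-map _ (kids S P))) (length-kids S P))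
length-kids (nothing ∷ S) (nothing ∷ P) = m≤n⇒m≤1+n (≤-trans (≤-reflexive (length-map _ (kids S P))) (length-kids S P))
length-kids (just a ∷ S)  (_ ∷ P)       = ≤-trans (≤-reflexive (length-map _ (kids S P))) (length-kids S P)

kids-size : (S P : Partial n r) {S′ : Partial n r} → S′ ∈ kids S P → size S′ ≡ suc (size S)
kids-size []            []            ()
kids-size (nothing ∷ S) (just b ∷ P)  (here refl) = refl
kids-size (nothing ∷ S) (just b ∷ P)  (there S′∈) with _ , k∈ , refl ← ∈-map⁻ _ S′∈ = kids-size S P k∈
kids-size (nothing ∷ S) (nothing ∷ P) S′∈         with _ , k∈ , refl ← ∈-map⁻ _ S′∈ = kids-size S P k∈
kids-size (just a ∷ S)  (_ ∷ P)       S′∈         with _ , k∈ , refl ← ∈-map⁻ _ S′∈ = cong suc (kids-size S P k∈)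

-- The extra hit of `Q` on `P` lies in a gap of `S`; adding that entry to `S` gives the required
-- kid.
kids-cover : (S P Q : Partial n r) → S ⊑ Q → hits S P < hits Q P → ∃[ S′ ] S′ ∈ kids S P × S′ ⊑ Q
kids-cover [] [] [] [] ()
kids-cover (nothing ∷ S) (just b ∷ P)  (nothing ∷ Q) (_ ∷ S⊑Q) lt with S′ , S′∈ , S′⊑Q ← kids-cover S P Q S⊑Q lt =
  nothing ∷ S′ , there (∈-map⁺ _ S′∈) , free ∷ S′⊑Q
kids-cover (nothing ∷ S) (just b ∷ P)  (just c ∷ Q)  (_ ∷ S⊑Q) lt with c ≟ b
... | yes refl = just b ∷ S , here refl , same ∷ S⊑Q
... | no _ with S′ , S′∈ , S′⊑Q ← kids-cover S P Q S⊑Q lt = nothing ∷ S′ , there (∈-map⁺ _ S′∈) , free ∷ S′⊑Q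
kids-cover (nothing ∷ S) (nothing ∷ P) (nothing ∷ Q) (_ ∷ S⊑Q) lt with S′ , S′∈ , S′⊑Q ← kids-cover S P Q S⊑Q lt =
  nothing ∷ S′ , ∈-map⁺ _ S′∈ , free ∷ S′⊑Q
kids-cover (nothing ∷ S) (nothing ∷ P) (just _ ∷ Q)  (_ ∷ S⊑Q) lt with S′ , S′∈ , S′⊑Q ← kids-cover S P Q S⊑Q lt =
  nothing ∷ S′ , ∈-map⁺ _ S′∈ , free ∷ S′⊑Q
kids-cover (just a ∷ S) (y ∷ P) (just a ∷ Q) (same ∷ S⊑Q) lt
  with S′ , S′∈ , S′⊑Q ← kids-cover S P Q S⊑Q (+-cancelˡ-< (hit (just a) y) _ _ lt) =
  just a ∷ S′ , ∈-map⁺ _ S′∈ , same ∷ S′⊑Q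

∈-kids : (S P Q : Partial n r) → S ⊑ Q → size Q ≡ suc (size S) → hits S P < hits Q P → Q ∈ kids S P
∈-kids S P Q S⊑Q |Q| lt with S′ , S′∈ , S′⊑Q ← kids-cover S P Q S⊑Q lt =
  subst (_∈ kids S P) (⊑-size≥⇒≡ S′⊑Q (≤-reflexive (trans |Q| (sym (kids-size S P S′∈))))) S′∈

rest : Partial n r → Tuple n r → Partial n r
rest []            []      = []
rest (nothing ∷ S) (b ∷ B) = just b ∷ rest S B
rest (just _ ∷ S)  (_ ∷ B) = nothing ∷ rest S B

-- Each kid adds to `T` a single entry of `B`, so a gain in hits on `A` means that `A` has this
-- entry; all kids together exhaust the gaps of `T`.
kids-hit⇒rest⊑ : (T : Partial n r) (B A : Tuple n r) →
  (∀ {S} → S ∈ kids T ⌜ B ⌝ → hits T ⌜ A ⌝ < hits S ⌜ A ⌝) → rest T B ⊑ ⌜ A ⌝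
kids-hit⇒rest⊑ []            []      []      _ = []
kids-hit⇒rest⊑ (nothing ∷ T) (b ∷ B) (a ∷ A) h with b ≟ a | h (here refl)
... | yes refl | _ = same ∷ kids-hit⇒rest⊑ T B A (λ S∈ → h (there (∈-map⁺ (nothing ∷_) S∈)))
... | no  _    | lt = contradiction lt (<-irrefl refl)
kids-hit⇒rest⊑ (just c ∷ T) (b ∷ B) (a ∷ A) h =
  free ∷ kids-hit⇒rest⊑ T B A (λ S∈ → +-cancelˡ-< (hit (just c) (just a)) _ _ (h (∈-map⁺ (just c ∷_) S∈)))

-- Cardinalities

+-*-zeroʳ : ∀ c p → c + p * 0 ≡ c
+-*-zeroʳ = solve-∀

box : (S : Partial (suc p) r) → Enum (λ A → S ⊑ ⌜ A ⌝) (suc p ^ gaps S)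
box []            = single []
box (nothing ∷ S) = split zero (box S) (box S) iff λ _ → iff
  where
  iff : ∀ {v A} → (nothing ∷ S ⊑ ⌜ v ∷ A ⌝) ⇔ (S ⊑ ⌜ A ⌝)
  iff = mk⇔ Pointwise.tail (free ∷_)
box {p} (just a ∷ S) = recount (+-*-zeroʳ _ p)
  (split a (box S) (none λ _ → id) (mk⇔ Pointwise.tail (same ∷_))
    (λ v≢a → mk⇔ (λ { (same ∷ _) → v≢a refl }) ⊥-elim))

-- The number of tuples of length `m` over `p + 1` values that agree with a fixed tuple somewhere.
-- The recursion splits on agreement in the first coordinate and avoids truncated subtraction;
-- `touchCount≡` gives the closed form.
touchCount : ℕ → ℕ → ℕ
touchCount p zero    = 0
touchCount p (suc m) = suc p ^ m + p * touchCount p m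

-- Since `A` extends `S`, its hits on `B` within the support of `S` number `hits S ⌜ B ⌝`; the
-- strict inequality therefore asks for an agreement of `A` with `B` in a gap of `S`.
Touch : Partial n r → Tuple n r → Tuple n r → Set
Touch S B A = S ⊑ ⌜ A ⌝ × hits S ⌜ B ⌝ < hits ⌜ A ⌝ ⌜ B ⌝

touch : (S : Partial (suc p) r) (B : Tuple (suc p) r) → Enum (Touch S B) (touchCount p (gaps S))
touch [] [] = none λ { [] () }
touch {p} (nothing ∷ S) (b ∷ B) = split b (box S) (touch S B) eq neq
  where
  eq : ∀ {A} → Touch (nothing ∷ S) (b ∷ B) (b ∷ A) ⇔ (S ⊑ ⌜ A ⌝)
  eq rewrite hit-same b = mk⇔ (Pointwise.tail ∘ proj₁) (λ S⊑A → free ∷ S⊑A , s≤s (hits-monoˡ S⊑A ⌜ B ⌝))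
  neq : ∀ {v A} → v ≢ b → Touch (nothing ∷ S) (b ∷ B) (v ∷ A) ⇔ Touch S B A
  neq v≢b rewrite hit-diff v≢b = mk⇔ (map₁ Pointwise.tail) (map₁ (free ∷_))
touch {p} (just a ∷ S) (b ∷ B) = recount (+-*-zeroʳ _ p)
  (split a (touch S B) (none λ _ → id)
    (mk⇔ (λ (sub , lt) → Pointwise.tail sub , +-cancelˡ-< (hit (just a) (just b)) _ _ lt)
         (λ (sub , lt) → same ∷ sub , +-monoʳ-< (hit (just a) (just b)) lt))
    (λ v≢a → mk⇔ (λ { (same ∷ _ , _) → v≢a refl }) ⊥-elim))

Fill : Partial n r → Tuple n r → Tuple n r → Set
Fill S B A = S ⊑ ⌜ A ⌝ × rest S B ⊑ ⌜ A ⌝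

point : (S : Partial (suc p) r) (B : Tuple (suc p) r) → Enum (Fill S B) 1
point [] [] = single ([] , [])
point {p} (nothing ∷ S) (b ∷ B) = recount (cong suc (*-zeroʳ p)) (split b (point S B) (none λ _ → id)
  (mk⇔ (λ (⊑₁ , ⊑₂) → Pointwise.tail ⊑₁ , Pointwise.tail ⊑₂) (λ (⊑₁ , ⊑₂) → free ∷ ⊑₁ , same ∷ ⊑₂))
  (λ v≢b → mk⇔ (λ { (_ , same ∷ _) → v≢b refl }) ⊥-elim))
point {p} (just a ∷ S) (b ∷ B) = recount (cong suc (*-zeroʳ p)) (split a (point S B) (none λ _ → id)
  (mk⇔ (λ (⊑₁ , ⊑₂) → Pointwise.tail ⊑₁ , Pointwise.tail ⊑₂) (λ (⊑₁ , ⊑₂) → same ∷ ⊑₁ , free ∷ ⊑₂))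
  (λ v≢a → mk⇔ (λ { (same ∷ _ , _) → v≢a refl }) ⊥-elim))

-- `A` misses exactly one entry of `S` and equals `B` in all gaps of `S`, which leaves `size S`
-- positions with `p` values each.
Off : Partial n r → Tuple n r → Tuple n r → Set
Off S B A = suc (hits S ⌜ A ⌝) ≡ size S × rest S B ⊑ ⌜ A ⌝

off : (S : Partial (suc p) r) (B : Tuple (suc p) r) → Enum (Off S B) (size S * p)
off [] [] = none λ { [] () }
off {p} (nothing ∷ S) (b ∷ B) = recount (+-*-zeroʳ _ p)
  (split b (off S B) (none λ _ → id)
    (mk⇔ (map₂ Pointwise.tail) (map₂ (same ∷_)))
    (λ v≢b → mk⇔ (λ { (_ , same ∷ _) → v≢b refl }) ⊥-elim))
off {p} (just a ∷ S) (b ∷ B) = recount (trans (+-comm (size S * p) _) (cong (_+ size S * p) (*-identityʳ p)))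
  (split a (off S B) (point S B) eq neq)
  where
  eq : ∀ {A} → Off (just a ∷ S) (b ∷ B) (a ∷ A) ⇔ Off S B A
  eq rewrite hit-same a = mk⇔ (λ (eq , sub) → suc-injective eq , Pointwise.tail sub) (λ (eq , sub) → cong suc eq , free ∷ sub)
  neq : ∀ {v A} → v ≢ a → Off (just a ∷ S) (b ∷ B) (v ∷ A) ⇔ Fill S B A
  neq {A = A} v≢a rewrite hit-diff (v≢a ∘ sym) =
    mk⇔ (λ (eq , sub) → size≤hits⇒⊑ S ⌜ A ⌝ (≤-reflexive (sym (suc-injective eq))) , Pointwise.tail sub)
        (λ (⊑₁ , ⊑₂) → cong suc (⊑⇒hits≡size ⊑₁) , free ∷ ⊑₂)

Near : Partial n r → Tuple n r → Set
Near S A = size S ≤ suc (hits S ⌜ A ⌝)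

-- The gaps are free; on the support there is either no miss or one position with one of `p` wrong
-- values.
near : (S : Partial (suc p) r) → Enum (Near S) (suc p ^ gaps S * suc (size S * p))
near [] = single z≤n
near {p} (nothing ∷ S) = recount (sym (*-assoc (suc p) (suc p ^ gaps S) _))
  (split zero (near S) (near S) (mk⇔ id id) (λ _ → mk⇔ id id))
near {p} (just a ∷ S) = recount (count-eq (suc p ^ gaps S) (size S) p) (split a (near S) (box S) eq neq)
  where
  count-eq : ∀ x s p → x * suc (s * p) + p * x ≡ x * suc (suc s * p)
  count-eq = solve-∀
  eq : ∀ {A} → Near (just a ∷ S) (a ∷ A) ⇔ Near S A
  eq rewrite hit-same a = mk⇔ s≤s⁻¹ s≤s
  neq : ∀ {v A} → v ≢ a → Near (just a ∷ S) (v ∷ A) ⇔ (S ⊑ ⌜ A ⌝)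
  neq {A = A} v≢a rewrite hit-diff (v≢a ∘ sym) =
    mk⇔ (size≤hits⇒⊑ S ⌜ A ⌝ ∘ s≤s⁻¹) (s≤s ∘ ≤-reflexive ∘ sym ∘ ⊑⇒hits≡size)

-- Meets and majorities

meet : Maybe (Fin n) → Maybe (Fin n) → Maybe (Fin n)
meet (just a) (just b) = if does (a ≟ b) then just a else nothing
meet (just _) nothing  = nothing
meet nothing  _        = nothing

meets : Partial n r → Partial n r → Partial n r
meets = Vec.zipWith meet

-- Collapses all the ways of not agreeing into one case that carries the values of both `hit` and
-- `meet`; `majority` needs only this distinction.
data HitView {n : ℕ} : Maybe (Fin n) → Maybe (Fin n) → Set where
  agreed : ∀ a → HitView (just a) (just a)
  missed : ∀ {x y} → hit x y ≡ 0 → meet x y ≡ nothing → HitView x y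

hitView : (x y : Maybe (Fin n)) → HitView x y
hitView nothing  _        = missed refl refl
hitView (just _) nothing  = missed refl refl
hitView (just a) (just b) with a ≟ b in eq
... | yes refl = agreed a
... | no  a≢b  = missed (cong (λ d → if does d then 1 else 0) eq) (cong (λ d → if does d then just a else nothing) eq)

meet-same : (a : Fin n) → meet (just a) (just a) ≡ just a
meet-same a with a ≟ a
... | yes _   = refl
... | no  a≢a = contradiction refl a≢a

meet-≼ˡ : (x y : Maybe (Fin n)) → meet x y ≼ x
meet-≼ˡ x y with hitView x y
... | agreed a     rewrite meet-same a = same
... | missed _ eq  rewrite eq          = free

meet-≼ʳ : (x y : Maybe (Fin n)) → meet x y ≼ y
meet-≼ʳ x y with hitView x y
... | agreed a     rewrite meet-same a = same
... | missed _ eq  rewrite eq          = free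

weight-meet : (x y : Maybe (Fin n)) → weight (meet x y) ≡ hit x y
weight-meet x y with hitView x y
... | agreed a        rewrite meet-same a | hit-same a = refl
... | missed eq₁ eq₂  rewrite eq₁ | eq₂                = refl

meets-⊑ˡ : (S Q : Partial n r) → meets S Q ⊑ S
meets-⊑ˡ []      []      = []
meets-⊑ˡ (x ∷ S) (y ∷ Q) = meet-≼ˡ x y ∷ meets-⊑ˡ S Q

meets-⊑ʳ : (S Q : Partial n r) → meets S Q ⊑ Q
meets-⊑ʳ []      []      = []
meets-⊑ʳ (x ∷ S) (y ∷ Q) = meet-≼ʳ x y ∷ meets-⊑ʳ S Q

size-meets : (S Q : Partial n r) → size (meets S Q) ≡ hits S Q
size-meets []      []      = refl
size-meets (x ∷ S) (y ∷ Q) = cong₂ _+_ (weight-meet x y) (size-meets S Q)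

module _ {n : ℕ} where

  -- m is the value taken by at least two of x, y and z.
  Majority : (x y z m : Maybe (Fin n)) → Set
  Majority x y z m =
    (weight m + 2 * hit (meet x y) z ≡ hit x y + hit x z + hit y z) ×
    (∀ a → 2 * weight m + (hit x a + hit y a + hit z a) ≤ 2 * hit m a + (weight x + weight y + weight z))

  -- Tested pair by pair. The equation counts agreeing pairs: none, one, or three if all agree. The
  -- inequality holds because an `a` that misses a fixed `m` also misses the two or more of `x`,
  -- `y`, `z` equal to `m`.
  majority : (x y z : Maybe (Fin n)) → ∃[ m ] Majority x y z m
  majority x y z with hitView x y
  ... | agreed c = just c , weight-eq , λ a → hit-ineq (hit (just c) a) (hit≤weight z a)
    where
    double : ∀ h → 1 + 2 * h ≡ 1 + h + h
    double = solve-∀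
    weight-eq : 1 + 2 * hit (meet (just c) (just c)) z ≡ hit (just c) (just c) + hit (just c) z + hit (just c) z
    weight-eq rewrite meet-same c | hit-same c = double (hit (just c) z)
    rearrangeˡ : ∀ h k → 2 * h + (2 + k) ≡ 2 + (h + h + k)
    rearrangeˡ = solve-∀
    hit-ineq : ∀ h {k w} → k ≤ w → 2 + (h + h + k) ≤ 2 * h + (2 + w)
    hit-ineq h k≤w = ≤-trans (≤-reflexive (sym (rearrangeˡ h _))) (+-monoʳ-≤ (2 * h) (+-monoʳ-≤ 2 k≤w))
  ... | missed hxy≡0 mxy≡ with hitView x z
  ...   | agreed c = just c , weight-eq , λ a → hit-ineq (hit (just c) a) (hit≤weight y a)
    where
    weight-eq : 1 + 2 * hit (meet (just c) y) (just c) ≡ hit (just c) y + hit (just c) (just c) + hit y (just c)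
    weight-eq rewrite mxy≡ | hit-comm y (just c) | hxy≡0 | hit-same c = refl
    rearrangeˡ : ∀ h k → 2 * h + (1 + k + 1) ≡ 2 + (h + k + h)
    rearrangeˡ = solve-∀
    hit-ineq : ∀ h {k w} → k ≤ w → 2 + (h + k + h) ≤ 2 * h + (1 + w + 1)
    hit-ineq h k≤w = ≤-trans (≤-reflexive (sym (rearrangeˡ h _))) (+-monoʳ-≤ (2 * h) (+-monoˡ-≤ 1 (+-monoʳ-≤ 1 k≤w)))
  ...   | missed hxz≡0 _ with hitView y z
  ...     | agreed c = just c , weight-eq , λ a → hit-ineq (hit (just c) a) (hit≤weight x a)
    where
    weight-eq : 1 + 2 * hit (meet x (just c)) (just c) ≡ hit x (just c) + hit x (just c) + hit (just c) (just c)
    weight-eq rewrite mxy≡ | hxy≡0 | hit-same c = refl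
    rearrangeˡ : ∀ h k → 2 * h + (k + 1 + 1) ≡ 2 + (k + h + h)
    rearrangeˡ = solve-∀
    hit-ineq : ∀ h {k w} → k ≤ w → 2 + (k + h + h) ≤ 2 * h + (w + 1 + 1)
    hit-ineq h k≤w = ≤-trans (≤-reflexive (sym (rearrangeˡ h _))) (+-monoʳ-≤ (2 * h) (+-monoˡ-≤ 1 (+-monoˡ-≤ 1 k≤w)))
  ...     | missed hyz≡0 _ = nothing , weight-eq ,
    λ a → +-mono-≤ (+-mono-≤ (hit≤weight x a) (hit≤weight y a)) (hit≤weight z a)
    where
    weight-eq : 2 * hit (meet x y) z ≡ hit x y + hit x z + hit y z
    weight-eq rewrite mxy≡ | hxy≡0 | hxz≡0 | hyz≡0 = refl

-- Summed over coordinates: every entry of the majority `Z` that `A` misses accounts for at least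
-- two missed entries among `S₁`, `S₂`, `S₃`.
majorities : (S₁ S₂ S₃ : Partial n r) → ∃[ Z ]
  (size Z + 2 * hits (meets S₁ S₂) S₃ ≡ hits S₁ S₂ + hits S₁ S₃ + hits S₂ S₃) ×
  (∀ A → 2 * size Z + (hits S₁ A + hits S₂ A + hits S₃ A) ≤ 2 * hits Z A + (size S₁ + size S₂ + size S₃))
majorities []       []       []       = [] , refl , λ { [] → z≤n }
majorities (x ∷ S₁) (y ∷ S₂) (z ∷ S₃)
  with m , eq , ineq ← majority x y z
  with Z , eqs , ineqs ← majorities S₁ S₂ S₃ =
  m ∷ Z ,
  trans (assemble-eqˡ (weight m) (size Z) (hit (meet x y) z) (hits (meets S₁ S₂) S₃)) (trans (cong₂ _+_ eq eqs) (assemble-eqʳ (hit x y) _ _ _ _ _)) ,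
  λ { (a ∷ A) → subst₂ _≤_ (assemble-≤ (weight m) _ (hit x a) _ _ _ _ _) (assemble-≤ (hit m a) _ (weight x) _ _ _ _ _)
                  (+-mono-≤ (ineq a) (ineqs A)) }
  where
  assemble-eqˡ : ∀ w s h k → (w + s) + 2 * (h + k) ≡ (w + 2 * h) + (s + 2 * k)
  assemble-eqˡ = solve-∀
  assemble-eqʳ : ∀ a b c d e f → (a + b + c) + (d + e + f) ≡ (a + d) + (b + e) + (c + f)
  assemble-eqʳ = solve-∀
  assemble-≤ : ∀ w s a b c d e f → (2 * w + (a + b + c)) + (2 * s + (d + e + f)) ≡ 2 * (w + s) + ((a + d) + (b + e) + (c + f))
  assemble-≤ = solve-∀

-- Common coordinates

⊑-lookup : {S : Partial n r} {A : Tuple n r} {a : Fin n} → S ⊑ ⌜ A ⌝ → ∀ ℓ → lookup S ℓ ≡ just a → lookup A ℓ ≡ a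
⊑-lookup {A = _ ∷ _} (same ∷ _)  zero    refl = refl
⊑-lookup {A = _ ∷ _} (_ ∷ S⊑A)   (suc ℓ) eq   = ⊑-lookup S⊑A ℓ eq

size≤∣tabulate∣ : (S : Partial n r) (b : Fin r → Bool) →
  (∀ ℓ {a} → lookup S ℓ ≡ just a → b ℓ ≡ true) → size S ≤ ∣ tabulate b ∣
size≤∣tabulate∣ []            b h = z≤n
size≤∣tabulate∣ (just a ∷ S)  b h rewrite h zero refl = s≤s (size≤∣tabulate∣ S (b ∘ suc) (h ∘ suc))
size≤∣tabulate∣ (nothing ∷ S) b h with b zero
... | true  = m≤n⇒m≤1+n (size≤∣tabulate∣ S (b ∘ suc) (h ∘ suc))
... | false = size≤∣tabulate∣ S (b ∘ suc) (h ∘ suc)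

-- Links non-triviality to partial tuples: no partial tuple with `t` or more entries is extended by
-- every member of an admissible family.
⊑⇒size≤∣common∣ : (S : Partial n r) (F : List (Tuple n r)) →
  (∀ {A} → A ∈ F → S ⊑ ⌜ A ⌝) → size S ≤ ∣ common F ∣
⊑⇒size≤∣common∣ S F S⊑F = size≤∣tabulate∣ S _ λ ℓ eq →
  dec-true (all? (λ A → all? (λ B → lookup A ℓ ≟ lookup B ℓ) F) F)
    (All.tabulate λ A∈F → All.tabulate λ B∈F → trans (⊑-lookup (S⊑F A∈F) ℓ eq) (sym (⊑-lookup (S⊑F B∈F) ℓ eq)))

∣tabulate∣≡0 : (b : Fin r → Bool) → (∀ ℓ → b ℓ ≡ false) → ∣ tabulate b ∣ ≡ 0
∣tabulate∣≡0 {zero}  b h = refl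
∣tabulate∣≡0 {suc r} b h rewrite h zero = ∣tabulate∣≡0 (b ∘ suc) (h ∘ suc)

-- The Hamming ball of radius 1 around `V`, centre included.
Ball : Tuple n r → Tuple n r → Set
Ball {r = r} V A = r ≤ suc (hits ⌜ V ⌝ ⌜ A ⌝)

⊑-refl : (S : Partial n r) → S ⊑ S
⊑-refl []            = []
⊑-refl (nothing ∷ S) = free ∷ ⊑-refl S
⊑-refl (just _ ∷ S)  = same ∷ ⊑-refl S

hits-self : (A : Tuple n r) → hits ⌜ A ⌝ ⌜ A ⌝ ≡ r
hits-self A = trans (⊑⇒hits≡size (⊑-refl ⌜ A ⌝)) (size-⌜⌝ A)

neighbour : (V : Tuple (suc (suc p)) r) (ℓ : Fin r) → ∃[ A ] Ball V A × lookup V ℓ ≢ lookup A ℓ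
-- `punchIn v zero` is a value other than `v`; it exists because there are at least two values.
neighbour (v ∷ V) zero    = punchIn v zero ∷ V ,
  s≤s (m≤n⇒m≤o+n _ (≤-reflexive (sym (hits-self V)))) , punchInᵢ≢i v zero ∘ sym
neighbour (v ∷ V) (suc ℓ) with A , A∈Ball , V≢A ← neighbour V ℓ = v ∷ A , inBall , V≢A
  where
  inBall : Ball (v ∷ V) (v ∷ A)
  inBall rewrite hit-same v = s≤s A∈Ball

ball⇒common-empty : (V : Tuple (suc (suc p)) r) (F : List (Tuple (suc (suc p)) r)) →
  (∀ {A} → Ball V A → A ∈ F) → ∣ common F ∣ ≡ 0
ball⇒common-empty V F Ball⊆F = ∣tabulate∣≡0 _ λ ℓ →
  dec-false (all? (λ A → all? (λ B → lookup A ℓ ≟ lookup B ℓ) F) F) λ all≡ →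
    let A , A∈Ball , V≢A = neighbour V ℓ
    in V≢A (All.lookup (All.lookup all≡ (Ball⊆F (m≤n⇒m≤1+n (≤-reflexive (sym (hits-self V)))))) (Ball⊆F A∈Ball))

enum⇒family : {t c : ℕ} {P : Tuple (suc (suc p)) r → Set} (V : Tuple (suc (suc p)) r) → Enum P c → 1 ≤ t →
  (∀ {A} → Ball V A → P A) → (∀ {A B} → P A → P B → t ≤ hits ⌜ A ⌝ ⌜ B ⌝) →
  Σ (Family (suc (suc p)) r) λ F → Admissible t F × length (members F) ≡ c
enum⇒family V E 1≤t Ball⊆P intersecting =
  family (list E) (unique E) ,
  ( All.tabulate (λ {A} A∈ → All.tabulate λ {B} B∈ →
      ≤-trans (intersecting (sound E A∈) (sound E B∈)) (≤-reflexive (sym (∣agree∣ A B))))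
  , ≤-trans (s≤s (≤-reflexive (ball⇒common-empty V (list E) (complete E ∘ Ball⊆P)))) 1≤t ) ,
  count E

-- The extremal families

ball⇒near : {S : Partial n r} {V A : Tuple n r} → S ⊑ ⌜ V ⌝ → Ball V A → Near S A
ball⇒near {r = r} {S = S} {V} {A} S⊑V A∈Ball = +-cancelʳ-≤ r _ _ (begin
  size S + r                                   ≤⟨ +-monoʳ-≤ (size S) A∈Ball ⟩
  size S + suc (hits ⌜ V ⌝ ⌜ A ⌝)              ≡⟨ +-suc (size S) _ ⟩
  suc (size S + hits ⌜ V ⌝ ⌜ A ⌝)              ≡⟨ cong (λ s → suc (s + _)) (trans (hits-comm ⌜ V ⌝ S) (⊑⇒hits≡size S⊑V)) ⟨
  suc (hits ⌜ V ⌝ S + hits ⌜ V ⌝ ⌜ A ⌝)        ≤⟨ s≤s (hits-triangle ⌜ V ⌝ S ⌜ A ⌝) ⟩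
  suc (hits S ⌜ A ⌝ + size ⌜ V ⌝)              ≡⟨ cong (λ s → suc (hits S ⌜ A ⌝ + s)) (size-⌜⌝ V) ⟩
  suc (hits S ⌜ A ⌝) + r                       ∎)
  where open ≤-Reasoning

segment : (V : Tuple n r) {s : ℕ} → s ≤ r → ∃[ S ] S ⊑ ⌜ V ⌝ × size S ≡ s
segment []      z≤n       = [] , [] , refl
segment (v ∷ V) z≤n       with S , S⊑V , |S| ← segment V z≤n = nothing ∷ S , free ∷ S⊑V , |S|
segment (v ∷ V) (s≤s s≤r) with S , S⊑V , |S| ← segment V s≤r = just v ∷ S , same ∷ S⊑V , cong suc |S|

rotate : ∀ a b c → a + (b + c) ≡ b + (a + c)
rotate = solve-∀

hits-rest : {S : Partial n r} {V : Tuple n r} → S ⊑ ⌜ V ⌝ → (A : Tuple n r) →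
  hits ⌜ V ⌝ ⌜ A ⌝ ≡ hits S ⌜ A ⌝ + hits (rest S V) ⌜ A ⌝
hits-rest {V = []}    []           []      = refl
hits-rest {S = nothing ∷ S} {V = v ∷ V} (free ∷ S⊑V) (a ∷ A) =
  trans (cong (hit (just v) (just a) +_) (hits-rest S⊑V A)) (rotate (hit (just v) (just a)) (hits S ⌜ A ⌝) (hits (rest S V) ⌜ A ⌝))
hits-rest {V = v ∷ V} (same ∷ S⊑V) (a ∷ A) =
  trans (cong (hit (just v) (just a) +_) (hits-rest S⊑V A)) (sym (+-assoc (hit (just v) (just a)) _ _))

size-rest : (S : Partial n r) (V : Tuple n r) → size (rest S V) ≡ gaps S
size-rest []            []      = refl
size-rest (nothing ∷ S) (v ∷ V) = cong suc (size-rest S V)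
size-rest (just _ ∷ S)  (v ∷ V) = size-rest S V

module _ {T : Partial n r} {V : Tuple n r} (T⊑V : T ⊑ ⌜ V ⌝) where

  off⇒ball : {A : Tuple n r} → Off T V A → Ball V A
  off⇒ball {A} (hits≡ , rest⊑A) = ≤-reflexive (begin
    r                                            ≡⟨ gaps+size T ⟨
    gaps T + size T                              ≡⟨ +-comm (gaps T) (size T) ⟩
    size T + gaps T                              ≡⟨ cong₂ _+_ hits≡ (trans (⊑⇒hits≡size rest⊑A) (size-rest T V)) ⟨
    suc (hits T ⌜ A ⌝ + hits (rest T V) ⌜ A ⌝)   ≡⟨ cong suc (hits-rest T⊑V A) ⟨
    suc (hits ⌜ V ⌝ ⌜ A ⌝)                       ∎)
    where open ≡-Reasoning

  -- Only one disagreement with `V` is available. If it lies outside `T`, or is absent, one of the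
  -- at least two gaps of `T` still agrees with `V`; if it lies in `T`, all gaps agree.
  ball⇒touch⊎off : {A : Tuple n r} → suc (suc (size T)) ≤ r → Ball V A → Touch T V A ⊎ Off T V A
  ball⇒touch⊎off {A} 2+|T|≤r A∈Ball with T ⊑? ⌜ A ⌝
  ... | yes T⊑A = inj₁ (T⊑A , (begin-strict
      hits T ⌜ V ⌝     ≡⟨ ⊑⇒hits≡size T⊑V ⟩
      size T           <⟨ s≤s⁻¹ (≤-trans 2+|T|≤r A∈Ball) ⟩
      hits ⌜ V ⌝ ⌜ A ⌝ ≡⟨ hits-comm ⌜ V ⌝ ⌜ A ⌝ ⟩
      hits ⌜ A ⌝ ⌜ V ⌝ ∎))
    where open ≤-Reasoning
  ... | no  T⋢A = inj₂ (hits≡ , size≤hits⇒⊑ (rest T V) ⌜ A ⌝ (+-cancelˡ-≤ (size T) _ _ (begin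
      size T + size (rest T V)                    ≡⟨ cong (size T +_) (size-rest T V) ⟩
      size T + gaps T                             ≡⟨ +-comm (size T) (gaps T) ⟩
      gaps T + size T                             ≡⟨ gaps+size T ⟩
      r                                           ≤⟨ A∈Ball ⟩
      suc (hits ⌜ V ⌝ ⌜ A ⌝)                      ≡⟨ cong suc (hits-rest T⊑V A) ⟩
      suc (hits T ⌜ A ⌝ + hits (rest T V) ⌜ A ⌝)  ≡⟨ cong (_+ hits (rest T V) ⌜ A ⌝) hits≡ ⟩
      size T + hits (rest T V) ⌜ A ⌝              ∎)))
    where
    open ≤-Reasoning
    hits≡ : suc (hits T ⌜ A ⌝) ≡ size T
    hits≡ = ≤-antisym (≰⇒> (T⋢A ∘ size≤hits⇒⊑ T ⌜ A ⌝)) (ball⇒near T⊑V A∈Ball)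

  -- `B` differs from `V` in at most one place, so at most one of the hits of `A` on `V` is lost.
  ball-intersecting : {s : ℕ} {A B : Tuple n r} → suc s ≤ hits ⌜ V ⌝ ⌜ A ⌝ → Ball V B → s ≤ hits ⌜ A ⌝ ⌜ B ⌝
  ball-intersecting {s} {A} {B} s<hits B∈Ball = +-cancelʳ-≤ r _ _ (begin
    s + r                                         ≤⟨ +-monoʳ-≤ s B∈Ball ⟩
    s + suc (hits ⌜ V ⌝ ⌜ B ⌝)                    ≡⟨ +-suc s _ ⟩
    suc s + hits ⌜ V ⌝ ⌜ B ⌝                      ≤⟨ +-monoˡ-≤ _ s<hits ⟩
    hits ⌜ V ⌝ ⌜ A ⌝ + hits ⌜ V ⌝ ⌜ B ⌝           ≤⟨ hits-triangle ⌜ V ⌝ ⌜ A ⌝ ⌜ B ⌝ ⟩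
    hits ⌜ A ⌝ ⌜ B ⌝ + size ⌜ V ⌝                 ≡⟨ cong (hits ⌜ A ⌝ ⌜ B ⌝ +_) (size-⌜⌝ V) ⟩
    hits ⌜ A ⌝ ⌜ B ⌝ + r                          ∎)
    where open ≤-Reasoning

  -- Two members of touch type share `T`. In every other pair one is in the ball around `V` and the
  -- other has at least `size T + 1` hits on `V`; for two of off type this uses `size T + 2 ≤ r`.
  touch⊎off-intersecting : {A B : Tuple n r} → suc (suc (size T)) ≤ r →
    Touch T V A ⊎ Off T V A → Touch T V B ⊎ Off T V B → size T ≤ hits ⌜ A ⌝ ⌜ B ⌝
  touch⊎off-intersecting {A} {B} _ (inj₁ (T⊑A , _)) (inj₁ (T⊑B , _)) = begin
    size T           ≡⟨ ⊑⇒hits≡size T⊑B ⟨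
    hits T ⌜ B ⌝     ≤⟨ hits-monoˡ T⊑A ⌜ B ⌝ ⟩
    hits ⌜ A ⌝ ⌜ B ⌝ ∎
    where open ≤-Reasoning
  touch⊎off-intersecting {A} {B} _ (inj₁ (_ , lt)) (inj₂ B-off) = ball-intersecting (touch-hits lt) (off⇒ball B-off)
    where
    touch-hits : hits T ⌜ V ⌝ < hits ⌜ A ⌝ ⌜ V ⌝ → size T < hits ⌜ V ⌝ ⌜ A ⌝
    touch-hits = subst₂ _<_ (⊑⇒hits≡size T⊑V) (hits-comm ⌜ A ⌝ ⌜ V ⌝)
  touch⊎off-intersecting {A} {B} 2+|T|≤r A-off@(inj₂ _) B-touch@(inj₁ _) =
    subst (size T ≤_) (hits-comm ⌜ B ⌝ ⌜ A ⌝) (touch⊎off-intersecting 2+|T|≤r B-touch A-off)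
  touch⊎off-intersecting {A} {B} 2+|T|≤r (inj₂ A-off) (inj₂ B-off) =
    ball-intersecting (s≤s⁻¹ (≤-trans 2+|T|≤r (off⇒ball A-off))) (off⇒ball B-off)

touch⇒¬off : {T : Partial n r} {V A : Tuple n r} → Touch T V A → ¬ Off T V A
touch⇒¬off (T⊑A , _) (hits≡ , _) = 1+n≢n (trans hits≡ (sym (⊑⇒hits≡size T⊑A)))

near-intersecting : {Z : Partial n r} {s : ℕ} {A B : Tuple n r} → size Z ≡ suc (suc s) → Near Z A → Near Z B →
  s ≤ hits ⌜ A ⌝ ⌜ B ⌝
near-intersecting {Z = Z} {s} {A} {B} |Z| A-near B-near = +-cancelʳ-≤ (size Z) _ _ (begin
  s + size Z                    ≤⟨ +-monoʳ-≤ s B-near ⟩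
  s + suc (hits Z ⌜ B ⌝)        ≡⟨ +-suc s _ ⟩
  suc s + hits Z ⌜ B ⌝          ≤⟨ +-monoˡ-≤ _ (s≤s⁻¹ (subst (_≤ suc (hits Z ⌜ A ⌝)) |Z| A-near)) ⟩
  hits Z ⌜ A ⌝ + hits Z ⌜ B ⌝   ≤⟨ hits-triangle Z ⌜ A ⌝ ⌜ B ⌝ ⟩
  hits ⌜ A ⌝ ⌜ B ⌝ + size Z     ∎)
  where open ≤-Reasoning

size⇒gaps : (S : Partial n r) {m : ℕ} → m + size S ≡ r → gaps S ≡ m
size⇒gaps S eq = +-cancelʳ-≡ (size S) _ _ (trans (gaps+size S) (sym eq))

-- The parameters encode `r = j + 2 + t` and `n = p + 1`, so that `r - t = j + 2` and no subtraction
-- occurs; `touchCount≡` and `nearSize≡` recover the forms in the theorem.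
touchSize nearSize : (t j p : ℕ) → ℕ
touchSize t j p = touchCount p (suc (suc j)) + t * p
nearSize  t j p = suc p ^ j * suc (suc (suc t) * p)

touchEnum : (t j : ℕ) (T : Partial (suc p) (suc (suc j) + t)) (V : Tuple (suc p) _) → size T ≡ t →
  Enum (λ A → Touch T V A ⊎ Off T V A) (touchSize t j p)
touchEnum {p} t j T V |T| =
  recount (cong₂ (λ g s → touchCount p g + s * p) (size⇒gaps T (cong (suc (suc j) +_) |T|)) |T|)
    (union (touch T V) (off T V) touch⇒¬off)

nearEnum : (t j : ℕ) (Z : Partial (suc p) (suc (suc j) + t)) → size Z ≡ suc (suc t) → Enum (Near Z) (nearSize t j p)
nearEnum {p} t j Z |Z| =
  recount (cong₂ (λ g s → suc p ^ g * suc (s * p)) (size⇒gaps Z gaps-eq) |Z|) (near Z)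
  where
  shift : ∀ j t → j + suc (suc t) ≡ suc (suc j) + t
  shift = solve-∀
  gaps-eq : j + size Z ≡ suc (suc j) + t
  gaps-eq = trans (cong (j +_) |Z|) (shift j t)

module _ (t j p : ℕ) (1≤t : 1 ≤ t) where

  private
    V : Tuple (suc (suc p)) (suc (suc j) + t)
    V = Vec.replicate _ zero

  touchFamily : Σ (Family (suc (suc p)) (suc (suc j) + t)) λ F → Admissible t F × length (members F) ≡ touchSize t j (suc p)
  touchFamily with T , T⊑V , |T| ← segment V (m≤n+m t (suc (suc j))) =
    enum⇒family V (touchEnum t j T V |T|) 1≤t (ball⇒touch⊎off T⊑V 2+|T|≤r)
      (λ {A} {B} P Q → subst (_≤ hits ⌜ A ⌝ ⌜ B ⌝) |T| (touch⊎off-intersecting T⊑V 2+|T|≤r P Q))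
    where
    2+|T|≤r : suc (suc (size T)) ≤ suc (suc j) + t
    2+|T|≤r = s≤s (s≤s (≤-trans (≤-reflexive |T|) (m≤n+m t j)))

  nearFamily : Σ (Family (suc (suc p)) (suc (suc j) + t)) λ F → Admissible t F × length (members F) ≡ nearSize t j (suc p)
  nearFamily with Z , Z⊑V , |Z| ← segment V (s≤s (s≤s (m≤n+m t j))) =
    enum⇒family V (nearEnum t j Z |Z|) 1≤t (ball⇒near Z⊑V) (λ {A} {B} → near-intersecting {Z = Z} {A = A} {B} |Z|)

-- The size of the first family

-- Union bound over the `m + 1` possible places of agreement, the other coordinates being free.
touchCount≤ : ∀ p m → touchCount p (suc m) ≤ suc m * suc p ^ m
touchCount≤ p zero    = s≤s (≤-reflexive (*-zeroʳ p))
touchCount≤ p (suc m) = +-monoʳ-≤ (suc p ^ suc m) (begin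
  p * touchCount p (suc m)        ≤⟨ *-mono-≤ (n≤1+n p) (touchCount≤ p m) ⟩
  suc p * (suc m * suc p ^ m)     ≡⟨ swap (suc p) (suc m) (suc p ^ m) ⟩
  suc m * suc p ^ suc m           ∎)
  where
  open ≤-Reasoning
  swap : ∀ a b c → a * (b * c) ≡ b * (a * c)
  swap = solve-∀

-- A lower bound of Bonferroni type with the crude constant `k^2` for `k = j + 2`. In the induction
-- `p * τ` is `N * τ` less `τ`: the hypothesis bounds the first term below and `touchCount≤` the
-- second above.
touchCount≥ : ∀ p j → suc (suc j) * suc p ^ suc j ≤ touchCount p (suc (suc j)) + suc (suc j) * suc (suc j) * suc p ^ j
touchCount≥ p zero    = subst₂ _≤_ (lhs p) (rhs p) (m≤m+n (2 * suc p) 3)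
  where
  lhs : ∀ p → 2 * suc p ≡ 2 * (suc p * 1)
  lhs = solve-∀
  rhs : ∀ p → 2 * suc p + 3 ≡ suc p * 1 + p * (1 + p * 0) + 4
  rhs = solve-∀
touchCount≥ p (suc j) = begin
  (3 + j) * N ^ (2 + j)                             ≡⟨ expand N j (N ^ suc j) ⟩
  N ^ (2 + j) + N * ((2 + j) * N ^ suc j)           ≤⟨ +-monoʳ-≤ (N ^ (2 + j)) (*-monoʳ-≤ N (touchCount≥ p j)) ⟩
  N ^ (2 + j) + N * (τ + (2 + j) * (2 + j) * N ^ j) ≡⟨ regroup p j τ (N ^ j) ⟩
  touchCount p (3 + j) + (τ + (2 + j) * (2 + j) * N ^ suc j)
    ≤⟨ +-monoʳ-≤ (touchCount p (3 + j)) (+-monoˡ-≤ _ (touchCount≤ p (suc j))) ⟩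
  touchCount p (3 + j) + ((2 + j) * N ^ suc j + (2 + j) * (2 + j) * N ^ suc j)
    ≤⟨ +-monoʳ-≤ (touchCount p (3 + j)) (subst ((2 + j) * N ^ suc j + (2 + j) * (2 + j) * N ^ suc j ≤_) (square j (N ^ suc j)) (m≤m+n _ _)) ⟩
  touchCount p (3 + j) + (3 + j) * (3 + j) * N ^ suc j ∎
  where
  open ≤-Reasoning
  N = suc p
  τ = touchCount p (2 + j)
  expand : ∀ n j x → (3 + j) * (n * x) ≡ n * x + n * ((2 + j) * x)
  expand = solve-∀
  regroup : ∀ p j τ x → suc p * (suc p * x) + suc p * (τ + (2 + j) * (2 + j) * x) ≡
    (suc p * (suc p * x) + p * τ) + (τ + (2 + j) * (2 + j) * (suc p * x))
  regroup = solve-∀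
  square : ∀ j x → ((2 + j) * x + (2 + j) * (2 + j) * x) + (3 + j) * x ≡ (3 + j) * (3 + j) * x
  square = solve-∀

-- With `n = p + 1` and `k = j + 2`, the leading coefficient on the left is smaller by one, and the
-- spare `n^(k-1)` absorbs all terms of order `n^(k-2)` once `n` is at least `k^2 + K`.
few-heavy-bound : ∀ p j K → suc (suc j) * suc (suc j) + K ≤ suc p →
  suc j * suc p ^ suc j + K * suc p ^ j ≤ touchCount p (suc (suc j))
few-heavy-bound p j K large = +-cancelʳ-≤ (c * N ^ j) _ _ (begin
  suc j * N ^ suc j + K * N ^ j + c * N ^ j   ≡⟨ collect (suc j * N ^ suc j) K c (N ^ j) ⟩
  suc j * N ^ suc j + (c + K) * N ^ j         ≤⟨ +-monoʳ-≤ (suc j * N ^ suc j) (*-monoˡ-≤ (N ^ j) large) ⟩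
  suc j * N ^ suc j + N ^ suc j               ≡⟨ +-comm (suc j * N ^ suc j) (N ^ suc j) ⟩
  suc (suc j) * N ^ suc j                     ≤⟨ touchCount≥ p j ⟩
  touchCount p (suc (suc j)) + c * N ^ j      ∎)
  where
  open ≤-Reasoning
  N = suc p
  c = suc (suc j) * suc (suc j)
  collect : ∀ a k c x → a + k * x + c * x ≡ a + (c + k) * x
  collect = solve-∀

touchCount≡ : ∀ p m → touchCount p m ≡ suc p ^ m ∸ p ^ m
touchCount≡ p m = trans (sym (m+n∸n≡m (touchCount p m) (p ^ m))) (cong (_∸ p ^ m) (complement m))
  where
  distribute : ∀ x p τ y → (x + p * τ) + p * y ≡ x + p * (τ + y)
  distribute = solve-∀
  complement : ∀ m → touchCount p m + p ^ m ≡ suc p ^ m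
  complement zero    = refl
  complement (suc m) = trans (distribute (suc p ^ m) p (touchCount p m) (p ^ m))
    (cong (λ x → suc p ^ m + p * x) (complement m))

nearSize≡ : ∀ t j p → nearSize t j p ≡ (t + 2) * suc p ^ suc j ∸ (t + 1) * suc p ^ j
nearSize≡ t j p = trans (sym (m+n∸n≡m (nearSize t j p) ((t + 1) * suc p ^ j)))
  (cong (_∸ (t + 1) * suc p ^ j) (complement t p (suc p ^ j)))
  where
  complement : ∀ t p x → x * suc ((2 + t) * p) + (t + 1) * x ≡ (t + 2) * (suc p * x)
  complement = solve-∀

-- Lengths of concatenations.

length-concatMap-≤ : {X Y : Set} (f : X → List Y) (c : ℕ) (xs : List X) → (∀ {x} → x ∈ xs → length (f x) ≤ c) →
  length (concatMap f xs) ≤ length xs * c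
length-concatMap-≤ f c []       h = z≤n
length-concatMap-≤ f c (x ∷ xs) h = ≤-trans (≤-reflexive (length-++ (f x)))
  (+-mono-≤ (h (here refl)) (length-concatMap-≤ f c xs (h ∘ there)))

length-concatMap-filter-≤ : {X Y : Set} {P : X → Set} (f : X → List Y) (P? : ∀ x → Dec (P x)) {c d : ℕ} (xs : List X) →
  (∀ {x} → x ∈ xs → P x → length (f x) ≤ c) → (∀ {x} → x ∈ xs → ¬ P x → length (f x) ≤ d) →
  length (concatMap f xs) ≤ length (filter P? xs) * c + length xs * d
length-concatMap-filter-≤ f P? [] _ _ = z≤n
length-concatMap-filter-≤ f P? {c} {d} (x ∷ xs) h h′
  with P? x | length-concatMap-filter-≤ f P? xs (h ∘ there) (h′ ∘ there)
... | yes Px | ih = begin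
  length (f x ++ concatMap f xs)                          ≡⟨ length-++ (f x) ⟩
  length (f x) + length (concatMap f xs)                  ≤⟨ +-mono-≤ (h (here refl) Px) ih ⟩
  c + (length (filter P? xs) * c + length xs * d)         ≡⟨ +-assoc c _ _ ⟨
  suc (length (filter P? xs)) * c + length xs * d         ≤⟨ +-monoʳ-≤ (suc (length (filter P? xs)) * c) (m≤n+m _ d) ⟩
  suc (length (filter P? xs)) * c + suc (length xs) * d   ∎
  where open ≤-Reasoning
... | no ¬Px | ih = begin
  length (f x ++ concatMap f xs)                          ≡⟨ length-++ (f x) ⟩
  length (f x) + length (concatMap f xs)                  ≤⟨ +-mono-≤ (h′ (here refl) ¬Px) ih ⟩
  d + (length (filter P? xs) * c + length xs * d)         ≡⟨ rotate d (length (filter P? xs) * c) (length xs * d) ⟩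
  length (filter P? xs) * c + suc (length xs) * d         ∎
  where open ≤-Reasoning

nonempty⇒∈ : {X : Set} (xs : List X) {m : ℕ} → suc m ≤ length xs → ∃[ x ] x ∈ xs
nonempty⇒∈ (x ∷ _) _ = x , here refl

_≟ᴾ_ : DecidableEquality (Partial n r)
_≟ᴾ_ = Vec.≡-dec (≡-dec _≟_)

-- The upper bound

module _ {p t j : ℕ} (F : List (Tuple (suc p) (suc (suc j) + t))) (F! : Unique F)
  (intersecting : ∀ {A B} → A ∈ F → B ∈ F → t ≤ hits ⌜ A ⌝ ⌜ B ⌝)
  (non-trivial : ∣ common F ∣ < t)
  {B₀ : Tuple (suc p) (suc (suc j) + t)} (B₀∈F : B₀ ∈ F)
  where

  private
    n′ = suc p
    r′ = suc (suc j) + t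

  -- If every member met `S` in `t` places, all of them would extend `S`, and the member `B₀` shows
  -- that `S` has `t` entries; that gives `t` common coordinates.
  non-cover : (S : Partial n′ r′) → size S ≤ t → ∃[ B ] B ∈ F × hits S ⌜ B ⌝ < t
  non-cover S |S|≤t with Any.any? (λ B → hits S ⌜ B ⌝ <? t) F
  ... | yes found = find found
  ... | no  none  = contradiction non-trivial (≤⇒≯ (begin
    t               ≤⟨ hits≥ B₀∈F ⟩
    hits S ⌜ B₀ ⌝   ≤⟨ hits≤size S ⌜ B₀ ⌝ ⟩
    size S          ≤⟨ ⊑⇒size≤∣common∣ S F (λ {B} B∈F → size≤hits⇒⊑ S ⌜ B ⌝ (≤-trans |S|≤t (hits≥ B∈F))) ⟩
    ∣ common F ∣    ∎))
    where
    open ≤-Reasoning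
    hits≥ : ∀ {B} → B ∈ F → t ≤ hits S ⌜ B ⌝
    hits≥ B∈F = ≮⇒≥ (λ lt → none (lose B∈F lt))

  Covers : List (Partial n′ r′) → Tuple n′ r′ → Set
  Covers L A = ∃[ S ] S ∈ L × S ⊑ ⌜ A ⌝

  -- Each `S` is replaced by its kids along a member `B` that it meets fewer than `t` times; a
  -- member extending `S` meets `B` at least `t` times and so extends a kid.
  refine : (s : ℕ) → s ≤ t → (L : List (Partial n′ r′)) → (∀ {S} → S ∈ L → size S ≡ s) →
    ∃[ L′ ] (∀ {S} → S ∈ L′ → size S ≡ suc s) × length L′ ≤ length L * r′ × (∀ {A} → A ∈ F → Covers L A → Covers L′ A)
  refine s s≤t []      |L| = [] , (λ ()) , z≤n , λ _ ()
  refine s s≤t (S ∷ L) |L|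
    with L′ , |L′| , L′≤ , covers ← refine s s≤t L (|L| ∘ there)
    with B , B∈F , hits<t ← non-cover S (≤-trans (≤-reflexive (|L| (here refl))) s≤t) =
    kids S ⌜ B ⌝ ++ L′ ,
    (λ S∈ → [ (λ S∈kids → trans (kids-size S ⌜ B ⌝ S∈kids) (cong suc (|L| (here refl)))) , |L′| ]′ (∈-++⁻ (kids S ⌜ B ⌝) S∈)) ,
    ≤-trans (≤-reflexive (length-++ (kids S ⌜ B ⌝)))
      (+-mono-≤ (≤-trans (length-kids S ⌜ B ⌝) (≤-trans (m≤m+n (gaps S) (size S)) (≤-reflexive (gaps+size S)))) L′≤) ,
    covers′
    where
    covers′ : ∀ {A} → A ∈ F → Covers (S ∷ L) A → Covers (kids S ⌜ B ⌝ ++ L′) A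
    covers′ {A} A∈F (_ , here refl , S⊑A) =
      let S′ , S′∈ , S′⊑A = kids-cover S ⌜ B ⌝ ⌜ A ⌝ S⊑A (<-≤-trans hits<t (intersecting A∈F B∈F))
      in S′ , ∈-++⁺ˡ S′∈ , S′⊑A
    covers′ A∈F (S′ , there S′∈L , S′⊑A) =
      let S″ , S″∈ , S″⊑A = covers A∈F (S′ , S′∈L , S′⊑A)
      in S″ , ∈-++⁺ʳ (kids S ⌜ B ⌝) S″∈ , S″⊑A

  generate : (s : ℕ) → s ≤ suc t →
    ∃[ L ] (∀ {S} → S ∈ L → size S ≡ s) × length L ≤ r′ ^ s × (∀ {A} → A ∈ F → Covers L A)
  generate zero    _         = [ Vec.replicate r′ nothing ] , (λ { (here refl) → size-nothing r′ }) , ≤-refl ,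
    λ {A} _ → _ , here refl , nothing-⊑ ⌜ A ⌝
    where
    size-nothing : ∀ r → size (Vec.replicate {A = Maybe (Fin n′)} r nothing) ≡ 0
    size-nothing zero    = refl
    size-nothing (suc r) = size-nothing r
    nothing-⊑ : ∀ {r} (Q : Partial n′ r) → Vec.replicate r nothing ⊑ Q
    nothing-⊑ []      = []
    nothing-⊑ (_ ∷ Q) = free ∷ nothing-⊑ Q
  generate (suc s) (s≤s s≤t)
    with L , |L| , L≤ , covers ← generate s (m≤n⇒m≤1+n s≤t)
    with L′ , |L′| , L′≤ , covers′ ← refine s s≤t L |L| =
    L′ , |L′| , ≤-trans L′≤ (≤-trans (*-monoˡ-≤ r′ L≤) (≤-reflexive (*-comm (r′ ^ s) r′))) , λ A∈F → covers′ A∈F (covers A∈F)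

  -- Heavy partial tuples.

  within : Partial n′ r′ → List (Tuple n′ r′)
  within S = filter (λ A → S ⊑? ⌜ A ⌝) F

  ∈-within⁻ : (S : Partial n′ r′) → ∀ {A} → A ∈ within S → A ∈ F × S ⊑ ⌜ A ⌝
  ∈-within⁻ S = ∈-filter⁻ (λ A → S ⊑? ⌜ A ⌝)

  -- Bounds the number of tuples extending one of at most `r′` partial tuples of size `t + 2`, each
  -- with `j` gaps.
  light : ℕ
  light = r′ * n′ ^ j

  Heavy : Partial n′ r′ → Set
  Heavy S = light < length (within S)

  within-≤ : (S : Partial n′ r′) → size S ≡ suc t → length (within S) ≤ n′ ^ suc j
  within-≤ S |S| = subst (λ g → length (within S) ≤ n′ ^ g)
    (size⇒gaps S (trans (cong (suc j +_) |S|) (+-suc (suc j) t)))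
    (bounded (box S) (Unique.filter⁺ _ F!) (proj₂ ∘ ∈-within⁻ S))

  -- If S met P in fewer than t places, every member extending S would also
  -- extend one of the at most r kids of S by P, so there would be few of them.
  heavy-hits : (S P : Partial n′ r′) → size S ≡ suc t → Heavy S →
    (∀ {A} → A ∈ F → t ≤ hits ⌜ A ⌝ P) → t ≤ hits S P
  heavy-hits S P |S| heavy P-hits = ≮⇒≥ λ hits<t → <⇒≱ heavy (begin
    length (within S)                                  ≤⟨ unique-⊆⇒length≤ (Unique.filter⁺ _ F!) (within⊆ hits<t) ⟩
    length (concatMap (list ∘ box) (kids S P))         ≤⟨ length-concatMap-≤ (list ∘ box) (n′ ^ j) (kids S P) box-≤ ⟩
    length (kids S P) * n′ ^ j
      ≤⟨ *-monoˡ-≤ (n′ ^ j) (≤-trans (length-kids S P) (≤-trans (m≤m+n (gaps S) (size S)) (≤-reflexive (gaps+size S)))) ⟩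
    light                                              ∎)
    where
    open ≤-Reasoning
    within⊆ : hits S P < t → within S ⊆ concatMap (list ∘ box) (kids S P)
    within⊆ hits<t {A} A∈ =
      let A∈F , S⊑A = ∈-within⁻ S A∈
          S′ , S′∈ , S′⊑A = kids-cover S P ⌜ A ⌝ S⊑A (<-≤-trans hits<t (P-hits A∈F))
      in ∈-concatMap⁺ (list ∘ box) (lose S′∈ (complete (box S′) S′⊑A))
    shift : ∀ j t → j + suc (suc t) ≡ suc (suc j) + t
    shift = solve-∀
    box-≤ : ∀ {S′} → S′ ∈ kids S P → length (list (box S′)) ≤ n′ ^ j
    box-≤ {S′} S′∈ = ≤-reflexive (trans (count (box S′)) (cong (n′ ^_) (size⇒gaps S′
      (trans (cong (j +_) (trans (kids-size S P S′∈) (cong suc |S|))) (shift j t)))))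

  heavy-hits-member : {S : Partial n′ r′} → size S ≡ suc t → Heavy S → ∀ {A} → A ∈ F → t ≤ hits S ⌜ A ⌝
  heavy-hits-member {S} |S| heavy {A} A∈F = heavy-hits S ⌜ A ⌝ |S| heavy (λ B∈F → intersecting B∈F A∈F)

  -- All members meet `Q` in `t` places by `heavy-hits-member`, so `Q` itself may take the role of
  -- `P` in `heavy-hits`.
  heavy-hits-heavy : {S Q : Partial n′ r′} → size S ≡ suc t → Heavy S → size Q ≡ suc t → Heavy Q → t ≤ hits S Q
  heavy-hits-heavy {S} {Q} |S| S-heavy |Q| Q-heavy = heavy-hits S Q |S| S-heavy λ {A} A∈F →
    subst (t ≤_) (hits-comm Q ⌜ A ⌝) (heavy-hits-member |Q| Q-heavy A∈F)

  -- Two intersections of size at least `t` inside the `t + 1` entries of one tuple overlap in at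
  -- least `t - 1`. Hence the triple meet has exactly `t - 1` entries, each pair shares exactly `t`,
  -- and the majority has `3t - 2(t - 1) = t + 2`.
  near-bound : {S₁ S₂ S₃ : Partial n′ r′} →
    size S₁ ≡ suc t → Heavy S₁ → size S₂ ≡ suc t → Heavy S₂ → size S₃ ≡ suc t → Heavy S₃ →
    hits (meets S₁ S₂) S₃ < t → length F ≤ nearSize t j p
  near-bound {S₁} {S₂} {S₃} |S₁| heavy₁ |S₂| heavy₂ |S₃| heavy₃ tri<t
    with Z , size-eq , miss ← majorities S₁ S₂ S₃ = bounded (nearEnum t j Z |Z|) F! F-near
    where
    open ≤-Reasoning
    h₁₂≥ = heavy-hits-heavy |S₁| heavy₁ |S₂| heavy₂
    h₁₃≥ = heavy-hits-heavy |S₁| heavy₁ |S₃| heavy₃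
    h₂₃≥ = heavy-hits-heavy |S₂| heavy₂ |S₃| heavy₃
    T = meets S₁ S₂
    tri = hits T S₃
    tri≥₁ : hits S₁ S₂ + hits S₁ S₃ ≤ suc (tri + t)
    tri≥₁ = begin
      hits S₁ S₂ + hits S₁ S₃ ≡⟨ cong (_+ hits S₁ S₃) (trans (hits-comm S₁ T) (trans (⊑⇒hits≡size (meets-⊑ˡ S₁ S₂)) (size-meets S₁ S₂))) ⟨
      hits S₁ T + hits S₁ S₃  ≤⟨ hits-triangle S₁ T S₃ ⟩
      tri + size S₁           ≡⟨ trans (cong (tri +_) |S₁|) (+-suc tri t) ⟩
      suc (tri + t)           ∎
    tri≥₂ : hits S₁ S₂ + hits S₂ S₃ ≤ suc (tri + t)
    tri≥₂ = begin
      hits S₁ S₂ + hits S₂ S₃ ≡⟨ cong (_+ hits S₂ S₃) (trans (hits-comm S₂ T) (trans (⊑⇒hits≡size (meets-⊑ʳ S₁ S₂)) (size-meets S₁ S₂))) ⟨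
      hits S₂ T + hits S₂ S₃  ≤⟨ hits-triangle S₂ T S₃ ⟩
      tri + size S₂           ≡⟨ trans (cong (tri +_) |S₂|) (+-suc tri t) ⟩
      suc (tri + t)           ∎
    h₁₂≡ : hits S₁ S₂ ≡ t
    h₁₂≡ = ≤-antisym (+-cancelʳ-≤ t _ _ (≤-trans (+-monoʳ-≤ _ h₁₃≥) (≤-trans tri≥₁ (+-monoˡ-≤ t tri<t)))) h₁₂≥
    h₁₃≡ : hits S₁ S₃ ≡ t
    h₁₃≡ = ≤-antisym (+-cancelˡ-≤ t _ _ (≤-trans (+-monoˡ-≤ _ h₁₂≥) (≤-trans tri≥₁ (+-monoˡ-≤ t tri<t)))) h₁₃≥
    h₂₃≡ : hits S₂ S₃ ≡ t
    h₂₃≡ = ≤-antisym (+-cancelˡ-≤ t _ _ (≤-trans (+-monoˡ-≤ _ h₁₂≥) (≤-trans tri≥₂ (+-monoˡ-≤ t tri<t)))) h₂₃≥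
    tri≡ : suc tri ≡ t
    tri≡ = ≤-antisym tri<t (+-cancelʳ-≤ t _ _ (≤-trans (≤-reflexive (sym (cong₂ _+_ h₁₂≡ h₁₃≡))) tri≥₁))
    three : ∀ x → suc x + suc x + suc x ≡ 3 + x + 2 * x
    three = solve-∀
    |Z| : size Z ≡ suc (suc t)
    |Z| = +-cancelʳ-≡ (2 * tri) _ _ (trans size-eq (trans (cong₂ _+_ (cong₂ _+_ h₁₂≡ h₁₃≡) h₂₃≡)
      (subst (λ s → s + s + s ≡ suc (suc s) + 2 * tri) tri≡ (three tri))))
    -- `A` misses at most one entry of each heavy tuple, three in all, and each missed entry of `Z`
    -- costs two of these; so at most one entry of `Z` is missed.
    F-near : ∀ {A} → A ∈ F → Near Z A
    F-near {A} A∈F = subst (_≤ suc (hits Z ⌜ A ⌝)) (sym |Z|) (s≤s (*-cancelˡ-< 2 _ _ (+-cancelʳ-≤ (3 * t + 3) _ _ (begin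
      suc (2 * t) + (3 * t + 3)                            ≡⟨ left t ⟩
      2 * suc (suc t) + (t + t + t)
        ≤⟨ +-monoʳ-≤ (2 * suc (suc t)) (+-mono-≤ (+-mono-≤ (heavy-hits-member |S₁| heavy₁ A∈F) (heavy-hits-member |S₂| heavy₂ A∈F)) (heavy-hits-member |S₃| heavy₃ A∈F)) ⟩
      2 * suc (suc t) + (hits S₁ ⌜ A ⌝ + hits S₂ ⌜ A ⌝ + hits S₃ ⌜ A ⌝)
        ≡⟨ cong (λ s → 2 * s + (hits S₁ ⌜ A ⌝ + hits S₂ ⌜ A ⌝ + hits S₃ ⌜ A ⌝)) |Z| ⟨
      2 * size Z + (hits S₁ ⌜ A ⌝ + hits S₂ ⌜ A ⌝ + hits S₃ ⌜ A ⌝)       ≤⟨ miss ⌜ A ⌝ ⟩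
      2 * hits Z ⌜ A ⌝ + (size S₁ + size S₂ + size S₃)
        ≡⟨ cong (2 * hits Z ⌜ A ⌝ +_) (trans (cong₂ _+_ (cong₂ _+_ |S₁| |S₂|) |S₃|) (right t)) ⟩
      2 * hits Z ⌜ A ⌝ + (3 * t + 3)                       ∎))))
      where
      left : ∀ t → suc (2 * t) + (3 * t + 3) ≡ 2 * suc (suc t) + (t + t + t)
      left = solve-∀
      right : ∀ t → suc t + suc t + suc t ≡ 3 * t + 3
      right = solve-∀

  -- A member B not containing T must contain the entry that each heavy extension
  -- of T adds to it; as there are k of them, they are all the kids of T by B.
  touch-bound : (T : Partial n′ r′) → size T ≡ t → (H : List (Partial n′ r′)) → Unique H → suc (suc j) ≤ length H →
    (∀ {S} → S ∈ H → size S ≡ suc t × Heavy S × T ⊑ S) → length F ≤ touchSize t j p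
  touch-bound T |T| H H! k≤|H| H-heavy
    with B , B∈F , hits<t ← non-cover T (≤-reflexive |T|) = bounded (touchEnum t j T B |T|) F! F⊆
    where
    H⊆kids : H ⊆ kids T ⌜ B ⌝
    H⊆kids {S} S∈H = let |S| , heavy , T⊑S = H-heavy S∈H in
      ∈-kids T ⌜ B ⌝ S T⊑S (trans |S| (cong suc (sym |T|))) (<-≤-trans hits<t (heavy-hits-member |S| heavy B∈F))
    gaps≡ : gaps T ≡ suc (suc j)
    gaps≡ = size⇒gaps T (cong (suc (suc j) +_) |T|)
    kids⊆H : kids T ⌜ B ⌝ ⊆ H
    kids⊆H = unique-⊆-length≥⇒⊇ _≟ᴾ_ H! H⊆kids (≤-trans (length-kids T ⌜ B ⌝) (≤-trans (≤-reflexive gaps≡) k≤|H|))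
    kids-hits : ∀ {A S} → A ∈ F → S ∈ kids T ⌜ B ⌝ → t ≤ hits S ⌜ A ⌝
    kids-hits A∈F S∈kids = let |S| , heavy , _ = H-heavy (kids⊆H S∈kids) in heavy-hits-member |S| heavy A∈F
    -- A heavy `S` has `t + 1` entries, contains the `t` entries of `T` and shares at least `t` with
    -- `A`, so `T` and `A` share at least `t - 1`.
    T-hits : ∀ {A} → A ∈ F → t ≤ suc (hits T ⌜ A ⌝)
    T-hits {A} A∈F with S , S∈H ← nonempty⇒∈ H k≤|H| with |S| , heavy , T⊑S ← H-heavy S∈H = +-cancelʳ-≤ (suc t) _ _ (begin
      t + suc t                         ≡⟨ +-comm t (suc t) ⟩
      suc t + t                         ≤⟨ +-monoʳ-≤ (suc t) (heavy-hits-member |S| heavy A∈F) ⟩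
      suc t + hits S ⌜ A ⌝              ≡⟨ cong (λ s → suc s + hits S ⌜ A ⌝) (trans (hits-comm S T) (trans (⊑⇒hits≡size T⊑S) |T|)) ⟨
      suc (hits S T + hits S ⌜ A ⌝)     ≤⟨ s≤s (hits-triangle S T ⌜ A ⌝) ⟩
      suc (hits T ⌜ A ⌝ + size S)       ≡⟨ cong (suc (hits T ⌜ A ⌝) +_) |S| ⟩
      suc (hits T ⌜ A ⌝) + suc t        ∎)
      where open ≤-Reasoning
    F⊆ : ∀ {A} → A ∈ F → Touch T B A ⊎ Off T B A
    F⊆ {A} A∈F with T ⊑? ⌜ A ⌝
    ... | yes T⊑A = inj₁ (T⊑A , <-≤-trans hits<t (intersecting A∈F B∈F))
    -- `T` has at most `t - 1` hits on `A` while every kid has at least `t`, so each entry added to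
    -- `T` from `B` belongs to `A`.
    ... | no  T⋢A = inj₂ (≤-antisym T-misses (≤-trans (≤-reflexive |T|) (T-hits A∈F)) ,
        kids-hit⇒rest⊑ T B A (λ S∈kids → <-≤-trans T-misses (≤-trans (≤-reflexive |T|) (kids-hits A∈F S∈kids))))
      where
      T-misses : hits T ⌜ A ⌝ < size T
      T-misses = ≰⇒> (T⋢A ∘ size≤hits⇒⊑ T ⌜ A ⌝)

  -- Two distinct heavy tuples of size `t + 1` share exactly `t` entries `T`. Either some heavy
  -- tuple meets `T` in fewer than `t` places, or all of them extend `T`.
  many-heavy : (H : List (Partial n′ r′)) → Unique H → suc (suc j) ≤ length H →
    (∀ {S} → S ∈ H → size S ≡ suc t × Heavy S) → length F ≤ touchSize t j p ⊔ nearSize t j p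
  many-heavy (S₁ ∷ []) _ (s≤s ())
  many-heavy H@(S₁ ∷ S₂ ∷ _) H!@((S₁≢S₂ ∷ _) ∷ _) k≤|H| H-heavy
    with |S₁| , heavy₁ ← H-heavy (here refl) | |S₂| , heavy₂ ← H-heavy (there (here refl))
    with Any.any? (λ S → hits (meets S₁ S₂) S <? t) H
  ... | yes found = let S₃ , S₃∈H , tri<t = find found
                        |S₃| , heavy₃ = H-heavy S₃∈H
                    in m≤n⇒m≤o⊔n _ (near-bound |S₁| heavy₁ |S₂| heavy₂ |S₃| heavy₃ tri<t)
  ... | no  none  = m≤n⇒m≤n⊔o _ (touch-bound T |T| H H! k≤|H| λ {S} S∈H →
      let |S| , heavy = H-heavy S∈H
      in |S| , heavy , size≤hits⇒⊑ T S (≤-trans (≤-reflexive |T|) (≮⇒≥ λ lt → none (lose S∈H lt))))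
    where
    T = meets S₁ S₂
    h≢1+t : hits S₁ S₂ ≢ suc t
    h≢1+t h≡ = S₁≢S₂ (⊑-size≥⇒≡ (size≤hits⇒⊑ S₁ S₂ (≤-reflexive (trans |S₁| (sym h≡)))) (≤-reflexive (trans |S₂| (sym |S₁|))))
    |T| : size T ≡ t
    |T| = trans (size-meets S₁ S₂) (≤-antisym
      (s≤s⁻¹ (≤∧≢⇒< (≤-trans (hits≤size S₁ S₂) (≤-reflexive |S₁|)) h≢1+t))
      (heavy-hits-heavy |S₁| heavy₁ |S₂| heavy₂))

  heavy? : (S : Partial n′ r′) → Dec (Heavy S)
  heavy? S = light <? length (within S)

  upper-bound : suc (suc j) * suc (suc j) + r′ ^ suc t * r′ ≤ suc p → length F ≤ touchSize t j p ⊔ nearSize t j p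
  upper-bound large with L , |L| , L≤ , covers ← generate (suc t) ≤-refl = by-heavy
    where
    open ≤-Reasoning
    -- Removing repetitions keeps the cover and makes the heavy tuples distinct, as `many-heavy`
    -- requires.
    D = deduplicate _≟ᴾ_ L
    |D| : ∀ {S} → S ∈ D → size S ≡ suc t
    |D| S∈D = |L| (∈-deduplicate⁻ _≟ᴾ_ L S∈D)
    H = filter heavy? D
    F⊆within : F ⊆ concatMap within D
    F⊆within A∈F = let S , S∈L , S⊑A = covers A∈F
      in ∈-concatMap⁺ within (lose (∈-deduplicate⁺ _≟ᴾ_ S∈L) (∈-filter⁺ (λ A → S ⊑? ⌜ A ⌝) A∈F S⊑A))
    by-heavy : length F ≤ touchSize t j p ⊔ nearSize t j p
    by-heavy with suc (suc j) ≤? length H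
    ... | yes k≤|H| = many-heavy H (Unique.filter⁺ heavy? (deduplicate-! _≟ᴾ_ L)) k≤|H| λ S∈H →
      let S∈D , heavy = ∈-filter⁻ heavy? S∈H in |D| S∈D , heavy
    -- With `k = j + 2`, at most `k - 1` heavy tuples have at most `n′ ^ (k - 1)` members each; the
    -- others number at most `r′ ^ (t + 1)` and have at most `light` members each.
    ... | no  k≰|H| = m≤n⇒m≤n⊔o _ (begin
      length F                                               ≤⟨ unique-⊆⇒length≤ F! F⊆within ⟩
      length (concatMap within D)                            ≤⟨ length-concatMap-filter-≤ within heavy? D (λ S∈D _ → within-≤ _ (|D| S∈D)) (λ _ → ≮⇒≥) ⟩
      length H * n′ ^ suc j + length D * light
        ≤⟨ +-mono-≤ (*-monoˡ-≤ (n′ ^ suc j) (s≤s⁻¹ (≰⇒> k≰|H|))) (*-monoˡ-≤ light (≤-trans (length-deduplicate _≟ᴾ_ L) L≤)) ⟩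
      suc j * n′ ^ suc j + r′ ^ suc t * (r′ * n′ ^ j)        ≡⟨ cong (suc j * n′ ^ suc j +_) (*-assoc (r′ ^ suc t) r′ (n′ ^ j)) ⟨
      suc j * n′ ^ suc j + r′ ^ suc t * r′ * n′ ^ j          ≤⟨ few-heavy-bound p j (r′ ^ suc t * r′) large ⟩
      touchCount p (suc (suc j))                             ≤⟨ m≤m+n _ (t * p) ⟩
      touchSize t j p                                        ∎)

-- The threshold and the exact value.

threshold : ℕ → ℕ → ℕ
-- The summand 2 makes `n` at least 2; the rest is `k ^ 2 + r ^ (t + 2)` for `k = j + 2` and
-- `r = j + 2 + t`, as `upper-bound` requires.
threshold t j = 2 + (suc (suc j) * suc (suc j) + (suc (suc j) + t) ^ suc t * (suc (suc j) + t))

iota0 : (t j p : ℕ) → 1 ≤ t → threshold t j ≤ suc (suc p) →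
  Iota0Is t (suc (suc p)) (suc (suc j) + t) (touchSize t j (suc p) ⊔ nearSize t j (suc p))
iota0 t j p 1≤t large = attained , bound
  where
  attained : Σ (Family _ _) λ F → Admissible t F × length (members F) ≡ touchSize t j (suc p) ⊔ nearSize t j (suc p)
  attained with ⊔-sel (touchSize t j (suc p)) (nearSize t j (suc p))
  ... | inj₁ eq = let F , admissible , |F| = touchFamily t j p 1≤t in F , admissible , trans |F| (sym eq)
  ... | inj₂ eq = let F , admissible , |F| = nearFamily t j p 1≤t in F , admissible , trans |F| (sym eq)
  bound : ∀ F → Admissible t F → length (members F) ≤ touchSize t j (suc p) ⊔ nearSize t j (suc p)
  -- The empty family is treated apart, since `upper-bound` takes a member `B₀`.
  bound (family []         _)  _                            = z≤n
  bound (family F@(_ ∷ _) F!) (intersecting , non-trivial) =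
    upper-bound F F! (λ {A} {B} A∈F B∈F → ≤-trans (All.lookup (All.lookup intersecting A∈F) B∈F) (≤-reflexive (∣agree∣ A B)))
      non-trivial (here refl) (≤-trans (m≤n+m _ 2) large)

theorem1p12 : ∀ (r t : ℕ) → 3 ≤ r → 1 ≤ t → t ≤ r ∸ 2 →
    ∃[ n₀ ] ∀ (n : ℕ) → n₀ ≤ n →
    Iota0Is t n r
    (((n ^ (r ∸ t) ∸ (n ∸ 1) ^ (r ∸ t)) + t * (n ∸ 1))
    ⊔ ((t + 2) * n ^ (r ∸ t ∸ 1) ∸ (t + 1) * n ^ (r ∸ t ∸ 2)))
theorem1p12 (suc zero) _ (s≤s ())
theorem1p12 r@(suc (suc m)) t _ 1≤t t≤m = threshold t j , λ { (suc (suc p)) large → at p large ; (suc zero) (s≤s ()) }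
  where
  -- Chosen so that `r = j + 2 + t`; the hypothesis `t ≤ r ∸ 2` makes this subtraction exact.
  j = m ∸ t
  r≡ : suc (suc j) + t ≡ r
  r≡ = cong (2 +_) (m∸n+n≡m t≤m)
  r∸t≡ : suc (suc j) ≡ r ∸ t
  r∸t≡ = trans (sym (m+n∸n≡m (suc (suc j)) t)) (cong (_∸ t) r≡)
  value : ℕ → ℕ → ℕ
  value n k = ((n ^ k ∸ (n ∸ 1) ^ k) + t * (n ∸ 1)) ⊔ ((t + 2) * n ^ (k ∸ 1) ∸ (t + 1) * n ^ (k ∸ 2))
  at : ∀ p → threshold t j ≤ suc (suc p) → Iota0Is t (suc (suc p)) r (value (suc (suc p)) (r ∸ t))
  at p large = subst₂ (λ r k → Iota0Is t (suc (suc p)) r (value (suc (suc p)) k)) r≡ r∸t≡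
    (subst (Iota0Is t (suc (suc p)) (suc (suc j) + t))
      (cong₂ _⊔_ (cong (_+ t * suc p) (touchCount≡ (suc p) (suc (suc j)))) (nearSize≡ t j (suc p)))
      (iota0 t j p 1≤t large))
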